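{- Let $c$ be a positive integer. For any integers $k\ge 2c$ and $t\ge c$, $$N(2,k,t)\ge k(t+2)+c.$$
   Context: For a finite set $X\subset\mathbb{R}^d$, $\mathrm{conv}(X)$ denotes its convex hull (with $\mathrm{conv}(\emptyset)=\emptyset$). For a positive integer $t$, a partition of a finite set $P\subset\mathbb{R}^d$ into $k$ pairwise disjoint subsets $P_1,\dots,P_k$ with union $P$ is called $t$-tolerant if for every set $Y\subset P$ of at most $t$ points, $\bigcap_{i=1}^k \mathrm{conv}(P_i\setminus Y)\neq\emptyset$. For positive integers $d,k,t$, $N(d,k,t)$ denotes the smallest positive integer $N$ such that every set $P$ of $N$ (distinct) points in $\mathbb{R}^d$ can be partitioned into $k$ subsets $P_1,\dots,P_k$ forming a $t$-tolerant partition. (Such an integer always exists.) -}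

module Defs where

open import Algebra.Bundles.Raw using (RawMonoid)
open import Algebra.Bundles using (CommutativeMonoid)
import Algebra.Definitions.RawMonoid as RawMonoidDefs
import Algebra.Properties.AbelianGroup as AbelianGroupProperties
import Algebra.Properties.CommutativeSemigroup as CommutativeSemigroupProperties
import Algebra.Properties.Ring as RingProperties
open import Data.Fin.Base using (Fin)
open import Data.Fin.Subset using (Subset; _∈_; _∉_; _∩_; _─_; ∣_∣; Empty)
open import Data.Nat.Base as ℕ using (ℕ; _⊔_)
import Data.Nat.Properties as ℕ
open import Data.Product.Base using (∃-syntax; _×_; _,_)
open import Data.Rational.Base as ℚ using (ℚ; 0ℚ; 1ℚ; ½; 1/_; Positive; positive)
import Data.Rational.Properties as ℚ
open import Data.Vec.Functional using (Vector)
open import Data.Vec.Functional.Relation.Binary.Pointwise using (Pointwise)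
open import Level using (0ℓ)
open import Relation.Binary.PropositionalEquality
  using (_≡_; _≢_; sym; trans; cong; cong₂; subst; module ≡-Reasoning)
open import Relation.Nullary.Negation using (¬_)

-- The real numbers: Cauchy sequences of rationals, with _≈_ as equality.

IsCauchy : (ℕ → ℚ) → Set
IsCauchy s = ∀ ε → 0ℚ ℚ.< ε →
  ∃[ M ] (∀ m n → M ℕ.≤ m → M ℕ.≤ n → ℚ.∣ s m ℚ.- s n ∣ ℚ.< ε)

record ℝ : Set where
  constructor mkℝ
  field
    seq    : ℕ → ℚ
    cauchy : IsCauchy seq

open ℝ public

infix 4 _≈_ _≤_

_≈_ : ℝ → ℝ → Set
x ≈ y = ∀ ε → 0ℚ ℚ.< ε →
  ∃[ M ] (∀ n → M ℕ.≤ n → ℚ.∣ seq x n ℚ.- seq y n ∣ ℚ.< ε)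

-- The slack ε is needed: a termwise comparison would not respect _≈_.
_≤_ : ℝ → ℝ → Set
x ≤ y = ∀ ε → 0ℚ ℚ.< ε →
  ∃[ M ] (∀ n → M ℕ.≤ n → seq x n ℚ.≤ seq y n ℚ.+ ε)

constant-cauchy : ∀ q → IsCauchy (λ _ → q)
constant-cauchy q ε 0<ε =
  0 , λ _ _ _ _ → subst (λ z → ℚ.∣ z ∣ ℚ.< ε) (sym (ℚ.+-inverseʳ q)) 0<ε

fromℚ : ℚ → ℝ
fromℚ q = mkℝ (λ _ → q) (constant-cauchy q)

0ℝ 1ℝ : ℝ
0ℝ = fromℚ 0ℚ
1ℝ = fromℚ 1ℚ

private
  0<p*q : ∀ {p q} → 0ℚ ℚ.< p → 0ℚ ℚ.< q → 0ℚ ℚ.< p ℚ.* q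
  0<p*q {p} {q} 0<p 0<q = ℚ.positive⁻¹ (p ℚ.* q)
    where instance
      _ : Positive (p ℚ.* q)
      _ = ℚ.pos*pos⇒pos p {{positive 0<p}} q {{positive 0<q}}

  halves : ∀ ε → ε ℚ.* ½ ℚ.+ ε ℚ.* ½ ≡ ε
  halves ε = trans (sym (ℚ.*-distribˡ-+ ε ½ ½)) (ℚ.*-identityʳ ε)

  p≡q+[p-q] : ∀ p q → p ≡ q ℚ.+ (p ℚ.- q)
  p≡q+[p-q] p q = sym (trans (sym (ℚ.+-assoc q p (ℚ.- q))) (xyx⁻¹≈y q p))
    where open AbelianGroupProperties ℚ.+-0-abelianGroup

  [a+b]-[c+d] : ∀ a b c d →
    (a ℚ.+ b) ℚ.- (c ℚ.+ d) ≡ (a ℚ.- c) ℚ.+ (b ℚ.- d)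
  [a+b]-[c+d] a b c d = trans
    (cong ((a ℚ.+ b) ℚ.+_) (ℚ.neg-distrib-+ c d))
    (interchange a b (ℚ.- c) (ℚ.- d))
    where open CommutativeSemigroupProperties
                 (CommutativeMonoid.commutativeSemigroup ℚ.+-0-commutativeMonoid)

  ab-cd : ∀ a b c d →
    a ℚ.* b ℚ.- c ℚ.* d ≡ a ℚ.* (b ℚ.- d) ℚ.+ (a ℚ.- c) ℚ.* d
  ab-cd a b c d = begin
    a ℚ.* b ℚ.- c ℚ.* d
      ≡⟨ cong (a ℚ.* b ℚ.+_) (\\-leftDividesʳ (a ℚ.* d) (ℚ.- (c ℚ.* d))) ⟨
    a ℚ.* b ℚ.+ (ℚ.- (a ℚ.* d) ℚ.+ (a ℚ.* d ℚ.- c ℚ.* d))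
      ≡⟨ ℚ.+-assoc (a ℚ.* b) (ℚ.- (a ℚ.* d)) (a ℚ.* d ℚ.- c ℚ.* d) ⟨
    (a ℚ.* b ℚ.- a ℚ.* d) ℚ.+ (a ℚ.* d ℚ.- c ℚ.* d)
      ≡⟨ cong₂ ℚ._+_ (x[y-z]≈xy-xz a b d) ([y-z]x≈yx-zx d a c) ⟨
    a ℚ.* (b ℚ.- d) ℚ.+ (a ℚ.- c) ℚ.* d ∎
    where
    open ≡-Reasoning
    open RingProperties ℚ.+-*-ring

  ∣p*q∣≤ : ∀ p q {B ε} → 0ℚ ℚ.< B → ℚ.∣ p ∣ ℚ.< B → ℚ.∣ q ∣ ℚ.< ε →
    ℚ.∣ p ℚ.* q ∣ ℚ.≤ B ℚ.* ε
  ∣p*q∣≤ p q {B} {ε} 0<B p<B q<ε = begin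
    ℚ.∣ p ℚ.* q ∣       ≡⟨ ℚ.∣p*q∣≡∣p∣*∣q∣ p q ⟩
    ℚ.∣ p ∣ ℚ.* ℚ.∣ q ∣ ≤⟨ ℚ.*-monoʳ-≤-nonNeg ℚ.∣ q ∣ {{ℚ.∣-∣-nonNeg q}} (ℚ.<⇒≤ p<B) ⟩
    B ℚ.* ℚ.∣ q ∣       ≤⟨ ℚ.*-monoˡ-≤-nonNeg B {{ℚ.pos⇒nonNeg B {{positive 0<B}}}} (ℚ.<⇒≤ q<ε) ⟩
    B ℚ.* ε             ∎
    where open ℚ.≤-Reasoning

  ∣ab-cd∣≤ : ∀ a b c d {A B δ} → 0ℚ ℚ.< A → 0ℚ ℚ.< B →
    ℚ.∣ a ∣ ℚ.< A → ℚ.∣ d ∣ ℚ.< B → ℚ.∣ a ℚ.- c ∣ ℚ.< δ → ℚ.∣ b ℚ.- d ∣ ℚ.< δ →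
    ℚ.∣ a ℚ.* b ℚ.- c ℚ.* d ∣ ℚ.≤ (A ℚ.+ B) ℚ.* δ
  ∣ab-cd∣≤ a b c d {A} {B} {δ} 0<A 0<B a<A d<B a-c<δ b-d<δ = begin
    ℚ.∣ a ℚ.* b ℚ.- c ℚ.* d ∣
      ≡⟨ cong ℚ.∣_∣ (ab-cd a b c d) ⟩
    ℚ.∣ a ℚ.* (b ℚ.- d) ℚ.+ (a ℚ.- c) ℚ.* d ∣
      ≤⟨ ℚ.∣p+q∣≤∣p∣+∣q∣ (a ℚ.* (b ℚ.- d)) ((a ℚ.- c) ℚ.* d) ⟩
    ℚ.∣ a ℚ.* (b ℚ.- d) ∣ ℚ.+ ℚ.∣ (a ℚ.- c) ℚ.* d ∣
      ≡⟨ cong (λ z → ℚ.∣ a ℚ.* (b ℚ.- d) ∣ ℚ.+ ℚ.∣ z ∣) (ℚ.*-comm (a ℚ.- c) d) ⟩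
    ℚ.∣ a ℚ.* (b ℚ.- d) ∣ ℚ.+ ℚ.∣ d ℚ.* (a ℚ.- c) ∣
      ≤⟨ ℚ.+-mono-≤
           {ℚ.∣ a ℚ.* (b ℚ.- d) ∣} {A ℚ.* δ} {ℚ.∣ d ℚ.* (a ℚ.- c) ∣} {B ℚ.* δ}
           (∣p*q∣≤ a (b ℚ.- d) 0<A a<A b-d<δ)
           (∣p*q∣≤ d (a ℚ.- c) 0<B d<B a-c<δ) ⟩
    A ℚ.* δ ℚ.+ B ℚ.* δ
      ≡⟨ ℚ.*-distribʳ-+ δ A B ⟨
    (A ℚ.+ B) ℚ.* δ ∎
    where open ℚ.≤-Reasoning

  shrink : ∀ S ε → 0ℚ ℚ.< S → 0ℚ ℚ.< ε → ∃[ δ ] 0ℚ ℚ.< δ × S ℚ.* δ ℚ.< ε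
  shrink S ε 0<S 0<ε = 1/ S ℚ.* (ε ℚ.* ½) , 0<δ , Sδ<ε
    where
    open ℚ.≤-Reasoning
    instance
      S-positive : Positive S
      S-positive = positive 0<S
      S-nonZero : ℚ.NonZero S
      S-nonZero = ℚ.pos⇒nonZero S

    0<ε/2 : 0ℚ ℚ.< ε ℚ.* ½
    0<ε/2 = 0<p*q 0<ε (ℚ.positive⁻¹ ½)

    0<δ : 0ℚ ℚ.< 1/ S ℚ.* (ε ℚ.* ½)
    0<δ = 0<p*q (ℚ.positive⁻¹ (1/ S) {{ℚ.1/pos⇒pos S}}) 0<ε/2

    Sδ<ε : S ℚ.* (1/ S ℚ.* (ε ℚ.* ½)) ℚ.< ε
    Sδ<ε = begin-strict
      S ℚ.* (1/ S ℚ.* (ε ℚ.* ½))  ≡⟨ ℚ.*-assoc S (1/ S) (ε ℚ.* ½) ⟨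
      (S ℚ.* 1/ S) ℚ.* (ε ℚ.* ½)  ≡⟨ cong (ℚ._* (ε ℚ.* ½)) (ℚ.*-inverseʳ S) ⟩
      1ℚ ℚ.* (ε ℚ.* ½)            ≡⟨ ℚ.*-identityˡ (ε ℚ.* ½) ⟩
      ε ℚ.* ½                     ≡⟨ ℚ.+-identityʳ (ε ℚ.* ½) ⟨
      ε ℚ.* ½ ℚ.+ 0ℚ              <⟨ ℚ.+-monoʳ-< (ε ℚ.* ½) 0<ε/2 ⟩
      ε ℚ.* ½ ℚ.+ ε ℚ.* ½         ≡⟨ halves ε ⟩
      ε                           ∎

  eventually-bounded : ∀ x →
    ∃[ B ] 0ℚ ℚ.< B × ∃[ M ] (∀ n → M ℕ.≤ n → ℚ.∣ seq x n ∣ ℚ.< B)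
  eventually-bounded x with cauchy x 1ℚ (ℚ.positive⁻¹ 1ℚ)
  ... | M , close = B , 0<B , M , bound
    where
    open ℚ.≤-Reasoning
    B = ℚ.∣ seq x M ∣ ℚ.+ 1ℚ

    0<B : 0ℚ ℚ.< B
    0<B = ℚ.+-mono-≤-< (ℚ.0≤∣p∣ (seq x M)) (ℚ.positive⁻¹ 1ℚ)

    bound : ∀ n → M ℕ.≤ n → ℚ.∣ seq x n ∣ ℚ.< B
    bound n M≤n = begin-strict
      ℚ.∣ seq x n ∣
        ≡⟨ cong ℚ.∣_∣ (p≡q+[p-q] (seq x n) (seq x M)) ⟩
      ℚ.∣ seq x M ℚ.+ (seq x n ℚ.- seq x M) ∣
        ≤⟨ ℚ.∣p+q∣≤∣p∣+∣q∣ (seq x M) (seq x n ℚ.- seq x M) ⟩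
      ℚ.∣ seq x M ∣ ℚ.+ ℚ.∣ seq x n ℚ.- seq x M ∣
        <⟨ ℚ.+-monoʳ-< ℚ.∣ seq x M ∣ (close n M M≤n ℕ.≤-refl) ⟩
      B ∎

-- abstract because unfolding the moduli makes type checking very slow
abstract
  +-cauchy : ∀ x y → IsCauchy (λ n → seq x n ℚ.+ seq y n)
  +-cauchy x y ε 0<ε
    with cauchy x (ε ℚ.* ½) (0<p*q 0<ε (ℚ.positive⁻¹ ½))
       | cauchy y (ε ℚ.* ½) (0<p*q 0<ε (ℚ.positive⁻¹ ½))
  ... | M₁ , close₁ | M₂ , close₂ = M₁ ⊔ M₂ , close
    where
    open ℚ.≤-Reasoning
    close : ∀ m n → M₁ ⊔ M₂ ℕ.≤ m → M₁ ⊔ M₂ ℕ.≤ n →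
      ℚ.∣ (seq x m ℚ.+ seq y m) ℚ.- (seq x n ℚ.+ seq y n) ∣ ℚ.< ε
    close m n ≤m ≤n = begin-strict
      ℚ.∣ (seq x m ℚ.+ seq y m) ℚ.- (seq x n ℚ.+ seq y n) ∣
        ≡⟨ cong ℚ.∣_∣ ([a+b]-[c+d] (seq x m) (seq y m) (seq x n) (seq y n)) ⟩
      ℚ.∣ (seq x m ℚ.- seq x n) ℚ.+ (seq y m ℚ.- seq y n) ∣
        ≤⟨ ℚ.∣p+q∣≤∣p∣+∣q∣ (seq x m ℚ.- seq x n) (seq y m ℚ.- seq y n) ⟩
      ℚ.∣ seq x m ℚ.- seq x n ∣ ℚ.+ ℚ.∣ seq y m ℚ.- seq y n ∣
        <⟨ ℚ.+-mono-<
             (close₁ m n (ℕ.m⊔n≤o⇒m≤o M₁ M₂ ≤m) (ℕ.m⊔n≤o⇒m≤o M₁ M₂ ≤n))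
             (close₂ m n (ℕ.m⊔n≤o⇒n≤o M₁ M₂ ≤m) (ℕ.m⊔n≤o⇒n≤o M₁ M₂ ≤n)) ⟩
      ε ℚ.* ½ ℚ.+ ε ℚ.* ½
        ≡⟨ halves ε ⟩
      ε ∎

  *-cauchy : ∀ x y → IsCauchy (λ n → seq x n ℚ.* seq y n)
  *-cauchy x y ε 0<ε =
    let A , 0<A , K₁ , bound₁  = eventually-bounded x
        B , 0<B , K₂ , bound₂  = eventually-bounded y
        δ , 0<δ , [A+B]δ<ε     = shrink (A ℚ.+ B) ε (ℚ.+-mono-< 0<A 0<B) 0<ε
        M₁ , close₁            = cauchy x δ 0<δ
        M₂ , close₂            = cauchy y δ 0<δ
        K≤ : ∀ {i} → (K₁ ⊔ K₂) ⊔ (M₁ ⊔ M₂) ℕ.≤ i → K₁ ⊔ K₂ ℕ.≤ i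
        K≤ = ℕ.m⊔n≤o⇒m≤o (K₁ ⊔ K₂) (M₁ ⊔ M₂)
        M≤ : ∀ {i} → (K₁ ⊔ K₂) ⊔ (M₁ ⊔ M₂) ℕ.≤ i → M₁ ⊔ M₂ ℕ.≤ i
        M≤ = ℕ.m⊔n≤o⇒n≤o (K₁ ⊔ K₂) (M₁ ⊔ M₂)
    in (K₁ ⊔ K₂) ⊔ (M₁ ⊔ M₂) , λ m n ≤m ≤n → ℚ.≤-<-trans
      {ℚ.∣ seq x m ℚ.* seq y m ℚ.- seq x n ℚ.* seq y n ∣} {(A ℚ.+ B) ℚ.* δ} {ε}
      (∣ab-cd∣≤ (seq x m) (seq y m) (seq x n) (seq y n) 0<A 0<B
        (bound₁ m (ℕ.m⊔n≤o⇒m≤o K₁ K₂ (K≤ ≤m)))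
        (bound₂ n (ℕ.m⊔n≤o⇒n≤o K₁ K₂ (K≤ ≤n)))
        (close₁ m n (ℕ.m⊔n≤o⇒m≤o M₁ M₂ (M≤ ≤m)) (ℕ.m⊔n≤o⇒m≤o M₁ M₂ (M≤ ≤n)))
        (close₂ m n (ℕ.m⊔n≤o⇒n≤o M₁ M₂ (M≤ ≤m)) (ℕ.m⊔n≤o⇒n≤o M₁ M₂ (M≤ ≤n))))
      [A+B]δ<ε

infixl 6 _+_
infixl 7 _*_

_+_ : ℝ → ℝ → ℝ
x + y = mkℝ (λ n → seq x n ℚ.+ seq y n) (+-cauchy x y)

_*_ : ℝ → ℝ → ℝ
x * y = mkℝ (λ n → seq x n ℚ.* seq y n) (*-cauchy x y)

+-rawMonoid : RawMonoid 0ℓ 0ℓ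
+-rawMonoid = record { Carrier = ℝ ; _≈_ = _≈_ ; _∙_ = _+_ ; ε = 0ℝ }

open RawMonoidDefs +-rawMonoid public using (sum)

Point : ℕ → Set
Point d = Vector ℝ d

infix 4 _≈ₚ_

_≈ₚ_ : ∀ {d} → Point d → Point d → Set
_≈ₚ_ = Pointwise _≈_

-- A set of n points is an injective family P : Vector (Point d) n, and its
-- subsets are given by subsets of the index set Fin n.

Distinct : ∀ {d n} → Vector (Point d) n → Set
Distinct P = ∀ {i j} → i ≢ j → ¬ (P i ≈ₚ P j)

combination : ∀ {d n} → Vector ℝ n → Vector (Point d) n → Point d
combination w P j = sum (λ i → w i * P i j)

-- q is a convex combination of the points P i with i ∈ S.  For empty S there
-- is no such q, since then the weights cannot sum to 1.
record _∈conv[_,_] {d n} (q : Point d) (P : Vector (Point d) n) (S : Subset n) : Set where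
  field
    weight      : Vector ℝ n
    nonNegative : ∀ i → 0ℝ ≤ weight i
    supported   : ∀ {i} → i ∉ S → weight i ≈ 0ℝ
    sum-one     : sum weight ≈ 1ℝ
    combines    : combination weight P ≈ₚ q

record IsPartition {n k} (parts : Vector (Subset n) k) : Set where
  field
    disjoint : ∀ {i j} → i ≢ j → Empty (parts i ∩ parts j)
    covers   : ∀ x → ∃[ i ] x ∈ parts i

IsTolerant : ∀ {d n k} → ℕ → Vector (Point d) n → Vector (Subset n) k → Set
IsTolerant {d} {n} t P parts = ∀ (Y : Subset n) → ∣ Y ∣ ℕ.≤ t →
  ∃[ q ] (∀ i → q ∈conv[ P , parts i ─ Y ])

-- The existence of a partition is the classical one: without the double
-- negation, AlwaysPartitionable would demand an algorithm computing a partition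
-- from rational approximations of the points, which the mathematical notion
-- does not.
AlwaysPartitionable : (d k t n : ℕ) → Set
AlwaysPartitionable d k t n = ∀ (P : Vector (Point d) n) → Distinct P →
  ¬ ¬ (∃[ parts ] IsPartition {n} {k} parts × IsTolerant t P parts)

-- N = N(d,k,t), as a relation since the existence of N(d,k,t) is a theorem.
record IsToleranceNumber (d k t N : ℕ) : Set where
  field
    isPositive : 1 ℕ.≤ N
    suffices   : AlwaysPartitionable d k t N
    least      : ∀ n → 1 ℕ.≤ n → AlwaysPartitionable d k t n → N ℕ.≤ n

{-# OPTIONS --safe #-}

-- Let m = k (t + 2) − 1.  Take m points p₀, …, p_{m−1} on a parabola and c
-- further points so deep inside their hull that a line through two of the p's
-- with a deep point on one closed side has at least k − 1 of the p's strictly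
-- on that side.  In a t-tolerant partition of the first N of these points every
-- part has more than t points, and at least t + 2 if it contains some p, since
-- each p is separated from all other points by its tangent.  Suppose a part A of t + 2 points has no deep
-- point.  Deleting all but two points of A leaves a segment which every other
-- part must cross, so, cyclically, there are at least k − 1 of the p's strictly
-- between any two points of A; this needs m ≥ k (t + 2).  Hence the sizes of the
-- parts, with deep points counted twice, are all at least t + 3.  Their sum is
-- at most N + c, which for N < k (t + 2) + c is less than k (t + 2) + 2c ≤ k (t + 3).

module Submission where

open import Defs hiding (_+_; _*_; _≤_)
import Defs as ℝ using (_*_; _≤_)
open import Algebra.Bundles using (Ring)
import Algebra.Properties.AbelianGroup as AbelianGroupProperties
import Algebra.Properties.CommutativeMonoid.Sum as CommutativeMonoidSum
import Algebra.Properties.Semiring.Sum as SemiringSum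
open import Data.Fin.Base as Fin using (Fin; zero; suc; toℕ; fromℕ<)
import Data.Fin.Properties as Fin
open import Data.Fin.Subset using (Subset; inside; outside; Nonempty; Empty; ⊤; ⊥;
  _∈_; _∉_; _⊆_; _∩_; _∪_; _─_; ∣_∣; ⁅_⁆)
open import Data.Fin.Subset.Properties
open import Data.Integer.Base as ℤ using (ℤ; +_; -[1+_]; 0ℤ; 1ℤ)
import Data.Integer.Properties as ℤ
open import Data.Integer.Tactic.RingSolver using (solve-∀)
open import Data.Nat.Base as ℕ using (ℕ; zero; suc; z≤n; s≤s; _+_; _*_; _∸_; _≤_; _<_; _⊔_)
import Data.Nat.Properties as ℕ
import Data.Nat.Tactic.RingSolver as ℕSolver
open import Data.Product.Base using (∃-syntax; _×_; _,_; proj₁; proj₂)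
open import Data.Rational.Base as ℚ using (ℚ; 0ℚ; 1ℚ; ½; 1/_; Positive; positive)
import Data.Rational.Properties as ℚ
import Data.Rational.Solver as ℚSolver
open import Data.Rational.Unnormalised.Base as ℚᵘ using (mkℚᵘ; *≡*; *≤*)
import Data.Rational.Unnormalised.Properties as ℚᵘ
open import Data.Sum.Base using (_⊎_; inj₁; inj₂)
open import Data.Vec.Base using ([]; _∷_; here; there)
open import Data.Vec.Functional using (Vector)
open import Function.Base using (_∘_)
open import Relation.Binary.PropositionalEquality
  using (_≡_; _≢_; refl; sym; trans; cong; cong₂; subst; subst₂; module ≡-Reasoning)
open import Relation.Nullary using (¬_; Dec; yes; no; contradiction; decidable-stable)
open import Relation.Nullary.Decidable using (_×-dec_; from-no)

-- Affine inequalities for convex combinations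

-- The configuration will have integer coordinates: there signs are decidable, polynomial identities
-- are left to the ring solver, and a strict inequality leaves a gap of at least 1.
ι : ℤ → ℚ
ι z = z ℚ./ 1

toℚᵘ-ι : ∀ z → ℚ.toℚᵘ (ι z) ℚᵘ.≃ mkℚᵘ z 0
toℚᵘ-ι z = ℚ.toℚᵘ-fromℚᵘ (mkℚᵘ z 0)

ι-homo-+ : ∀ y z → ι (y ℤ.+ z) ≡ ι y ℚ.+ ι z
ι-homo-+ y z = ℚ.toℚᵘ-injective (begin-equality
  ℚ.toℚᵘ (ι (y ℤ.+ z))             ≃⟨ toℚᵘ-ι (y ℤ.+ z) ⟩
  mkℚᵘ (y ℤ.+ z) 0                 ≃⟨ *≡* (cong (ℤ._* 1ℤ) (cong₂ ℤ._+_ (sym (ℤ.*-identityʳ y)) (sym (ℤ.*-identityʳ z)))) ⟩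
  mkℚᵘ y 0 ℚᵘ.+ mkℚᵘ z 0           ≃⟨ ℚᵘ.+-cong (toℚᵘ-ι y) (toℚᵘ-ι z) ⟨
  ℚ.toℚᵘ (ι y) ℚᵘ.+ ℚ.toℚᵘ (ι z)   ≃⟨ ℚ.toℚᵘ-homo-+ (ι y) (ι z) ⟨
  ℚ.toℚᵘ (ι y ℚ.+ ι z)             ∎)
  where
  open ℚᵘ.≤-Reasoning

ι-homo-* : ∀ y z → ι (y ℤ.* z) ≡ ι y ℚ.* ι z
ι-homo-* y z = ℚ.toℚᵘ-injective (begin-equality
  ℚ.toℚᵘ (ι (y ℤ.* z))             ≃⟨ toℚᵘ-ι (y ℤ.* z) ⟩
  mkℚᵘ y 0 ℚᵘ.* mkℚᵘ z 0           ≃⟨ ℚᵘ.*-cong (toℚᵘ-ι y) (toℚᵘ-ι z) ⟨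
  ℚ.toℚᵘ (ι y) ℚᵘ.* ℚ.toℚᵘ (ι z)   ≃⟨ ℚ.toℚᵘ-homo-* (ι y) (ι z) ⟨
  ℚ.toℚᵘ (ι y ℚ.* ι z)             ∎)
  where open ℚᵘ.≤-Reasoning

ι-mono-≤ : ∀ {y z} → y ℤ.≤ z → ι y ℚ.≤ ι z
ι-mono-≤ {y} {z} y≤z = ℚ.toℚᵘ-cancel-≤ (begin
  ℚ.toℚᵘ (ι y)   ≃⟨ toℚᵘ-ι y ⟩
  mkℚᵘ y 0       ≤⟨ *≤* (ℤ.*-monoʳ-≤-nonNeg 1ℤ y≤z) ⟩
  mkℚᵘ z 0       ≃⟨ toℚᵘ-ι z ⟨
  ℚ.toℚᵘ (ι z)   ∎)
  where open ℚᵘ.≤-Reasoning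

ι-injective : ∀ {y z} → ι y ≡ ι z → y ≡ z
ι-injective {y} {z} ιy≡ιz with ℚᵘ.≃-trans (ℚᵘ.≃-sym (toℚᵘ-ι y)) (ℚᵘ.≃-trans (ℚ.toℚᵘ-cong ιy≡ιz) (toℚᵘ-ι z))
... | *≡* y*1≡z*1 = trans (sym (ℤ.*-identityʳ y)) (trans y*1≡z*1 (ℤ.*-identityʳ z))

fromℚ-injective : ∀ {p q} → fromℚ p ≈ fromℚ q → p ≡ q
fromℚ-injective {p} {q} p≈q = ℚ.≤-antisym (≤-from p≈q) (≤-from q≈p)
  where
  swap : ∀ p q → ℚ.- (p ℚ.- q) ≡ q ℚ.- p
  swap = solve 2 (λ p q → :- (p :- q) := q :- p) refl
    where open ℚSolver.+-*-Solver

  q≈p : fromℚ q ≈ fromℚ p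
  q≈p ε 0<ε with p≈q ε 0<ε
  ... | M , close = M , λ n M≤n → subst (ℚ._< ε) (trans (sym (ℚ.∣-p∣≡∣p∣ (p ℚ.- q))) (cong ℚ.∣_∣ (swap p q))) (close n M≤n)

  ≤-from : ∀ {p q} → fromℚ p ≈ fromℚ q → p ℚ.≤ q
  ≤-from {p} {q} p≈q = ℚ.≮⇒≥ λ q<p →
    -- The gap between the two constants is itself a tolerance that they violate.
    let ε   = p ℚ.- q
        0<ε = subst (ℚ._< ε) (ℚ.+-inverseʳ q) (ℚ.+-monoˡ-< (ℚ.- q) q<p)
        M , close = p≈q ε 0<ε
    in ℚ.<-irrefl (ℚ.0≤p⇒∣p∣≡p (ℚ.<⇒≤ 0<ε)) (close M ℕ.≤-refl)

-- A condition on plain rational sequences: an affine form can then be evaluated term by term,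
-- without building its value as a real number.
EventuallyNonNegative : (ℕ → ℚ) → Set
EventuallyNonNegative s = ∀ ε → 0ℚ ℚ.< ε → ∃[ M ] (∀ n → M ≤ n → ℚ.- ε ℚ.≤ s n)

Null : (ℕ → ℚ) → Set
Null s = EventuallyNonNegative s × EventuallyNonNegative (λ n → ℚ.- s n)

nonNegative-cong : ∀ {r s} → (∀ n → r n ≡ s n) →
  EventuallyNonNegative r → EventuallyNonNegative s
nonNegative-cong r≡s r≥0 ε 0<ε with r≥0 ε 0<ε
... | M , bound = M , λ n M≤n → subst (ℚ.- ε ℚ.≤_) (r≡s n) (bound n M≤n)

nonNegative-const : ∀ {q} → 0ℚ ℚ.≤ q → EventuallyNonNegative (λ _ → q)
nonNegative-const 0≤q ε 0<ε = 0 , λ _ _ →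
  ℚ.≤-trans (ℚ.neg-antimono-≤ (ℚ.<⇒≤ 0<ε)) 0≤q

nonNegative-+ : ∀ {r s} → EventuallyNonNegative r → EventuallyNonNegative s →
  EventuallyNonNegative (λ n → r n ℚ.+ s n)
nonNegative-+ {r} {s} r≥0 s≥0 ε 0<ε
  with r≥0 (ε ℚ.* ½) 0<ε/2 | s≥0 (ε ℚ.* ½) 0<ε/2
  where
  0<ε/2 : 0ℚ ℚ.< ε ℚ.* ½
  0<ε/2 = ℚ.positive⁻¹ (ε ℚ.* ½) {{ℚ.pos*pos⇒pos ε {{positive 0<ε}} ½}}
... | M₁ , bound₁ | M₂ , bound₂ = M₁ ⊔ M₂ , λ n M≤n →
  subst (ℚ._≤ r n ℚ.+ s n) halves
    (ℚ.+-mono-≤ (bound₁ n (ℕ.m⊔n≤o⇒m≤o M₁ M₂ M≤n)) (bound₂ n (ℕ.m⊔n≤o⇒n≤o M₁ M₂ M≤n)))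
  where
  open ℚSolver.+-*-Solver
  halves : ℚ.- (ε ℚ.* ½) ℚ.+ ℚ.- (ε ℚ.* ½) ≡ ℚ.- ε
  halves = solve 1 (λ e → :- (e :* con ½) :+ :- (e :* con ½) := :- e) refl ε

nonNegative-* : ∀ {p s} → 0ℚ ℚ.≤ p → EventuallyNonNegative s →
  EventuallyNonNegative (λ n → p ℚ.* s n)
nonNegative-* {p} {s} 0≤p s≥0 ε 0<ε = let M , bound = s≥0 δ 0<δ in M , λ n M≤n → begin
  ℚ.- ε               ≡⟨ cong ℚ.-_ [p+1]δ≡ε ⟨
  ℚ.- ((p ℚ.+ 1ℚ) ℚ.* δ)
    ≤⟨ ℚ.neg-antimono-≤ (ℚ.*-monoʳ-≤-nonNeg δ {{ℚ.pos⇒nonNeg δ}} (ℚ.<⇒≤ p<p+1)) ⟩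
  ℚ.- (p ℚ.* δ)       ≡⟨ ℚ.neg-distribʳ-* p δ ⟩
  p ℚ.* ℚ.- δ         ≤⟨ ℚ.*-monoˡ-≤-nonNeg p (bound n M≤n) ⟩
  p ℚ.* s n           ∎
  where
  open ℚ.≤-Reasoning
  p<p+1 : p ℚ.< p ℚ.+ 1ℚ
  p<p+1 = subst (ℚ._< p ℚ.+ 1ℚ) (ℚ.+-identityʳ p) (ℚ.+-monoʳ-< p (ℚ.positive⁻¹ 1ℚ))
  instance
    _ : ℚ.NonNegative p
    _ = ℚ.nonNegative 0≤p
    _ : Positive ε
    _ = positive 0<ε
    p+1-positive : Positive (p ℚ.+ 1ℚ)
    p+1-positive = positive (ℚ.≤-<-trans 0≤p p<p+1)
    p+1-nonZero : ℚ.NonZero (p ℚ.+ 1ℚ)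
    p+1-nonZero = ℚ.pos⇒nonZero (p ℚ.+ 1ℚ)
  -- Dividing by `p + 1` instead of `p` covers `p ≡ 0` as well.
  δ : ℚ
  δ = 1/ (p ℚ.+ 1ℚ) ℚ.* ε
  instance
    δ-positive : Positive δ
    δ-positive = ℚ.pos*pos⇒pos (1/ (p ℚ.+ 1ℚ)) {{ℚ.1/pos⇒pos (p ℚ.+ 1ℚ)}} ε
  0<δ : 0ℚ ℚ.< δ
  0<δ = ℚ.positive⁻¹ δ
  [p+1]δ≡ε : (p ℚ.+ 1ℚ) ℚ.* δ ≡ ε
  [p+1]δ≡ε = begin-equality
    (p ℚ.+ 1ℚ) ℚ.* δ
      ≡⟨ ℚ.*-assoc (p ℚ.+ 1ℚ) (1/ (p ℚ.+ 1ℚ)) ε ⟨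
    (p ℚ.+ 1ℚ) ℚ.* 1/ (p ℚ.+ 1ℚ) ℚ.* ε
      ≡⟨ cong (ℚ._* ε) (ℚ.*-inverseʳ (p ℚ.+ 1ℚ)) ⟩
    1ℚ ℚ.* ε          ≡⟨ ℚ.*-identityˡ ε ⟩
    ε                 ∎

-- A null sequence may be scaled by a factor of either sign, so that the error terms of a convex
-- combination can be multiplied by arbitrary coefficients.
nonNegative-null-* : ∀ p {s} → Null s → EventuallyNonNegative (λ n → p ℚ.* s n)
nonNegative-null-* p {s} (s≥0 , s≤0) with ℚ.≤-total 0ℚ p
... | inj₁ 0≤p = nonNegative-* 0≤p s≥0
... | inj₂ p≤0 = nonNegative-cong (λ n → -p*-s≡p*s (s n))
    (nonNegative-* {ℚ.- p} (ℚ.neg-antimono-≤ p≤0) s≤0)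
  where
  open ℚSolver.+-*-Solver
  -p*-s≡p*s : ∀ x → ℚ.- p ℚ.* ℚ.- x ≡ p ℚ.* x
  -p*-s≡p*s = solve 2 (λ p x → :- p :* :- x := p :* x) refl p

open CommutativeMonoidSum ℚ.+-0-commutativeMonoid using ()
  renaming (sum to sumℚ; ∑-distrib-+ to sumℚ-+; sum-cong-≗ to sumℚ-cong)
open SemiringSum (Ring.semiring ℚ.+-*-ring) using ()
  renaming (*-distribˡ-sum to *-distribˡ-sumℚ)

seq-sum : ∀ {n} (v : Vector ℝ n) k → seq (sum v) k ≡ sumℚ (λ i → seq (v i) k)
seq-sum {zero}  v k = refl
seq-sum {suc n} v k = cong (seq (v zero) k ℚ.+_) (seq-sum (v ∘ suc) k)

nonNegative-sum : ∀ {n} {s : Fin n → ℕ → ℚ} → (∀ i → EventuallyNonNegative (s i)) →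
  EventuallyNonNegative (λ k → sumℚ (λ i → s i k))
nonNegative-sum {zero}  s≥0 = nonNegative-const ℚ.≤-refl
nonNegative-sum {suc n} s≥0 = nonNegative-+ (s≥0 zero) (nonNegative-sum (s≥0 ∘ suc))

≤⇒nonNegative : ∀ {x} → 0ℝ ℝ.≤ x → EventuallyNonNegative (seq x)
≤⇒nonNegative {x} 0≤x ε 0<ε with 0≤x ε 0<ε
... | M , bound = M , λ n M≤n → subst (ℚ._≤ seq x n) (ℚ.+-identityˡ (ℚ.- ε))
    (subst (0ℚ ℚ.+ ℚ.- ε ℚ.≤_) (cancel (seq x n)) (ℚ.+-monoˡ-≤ (ℚ.- ε) (bound n M≤n)))
  where
  open ℚSolver.+-*-Solver
  cancel : ∀ y → (y ℚ.+ ε) ℚ.+ ℚ.- ε ≡ y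
  cancel = solve 2 (λ e y → (y :+ e) :+ :- e := y) refl ε

≈⇒null : ∀ x y → x ≈ y → Null (λ n → seq x n ℚ.- seq y n)
≈⇒null x y x≈y =
    (λ ε 0<ε → let M , close = x≈y ε 0<ε in M , λ n M≤n →
      ℚ.≤-trans (ℚ.neg-antimono-≤ (ℚ.<⇒≤ (close n M≤n))) (-∣p∣≤p (seq x n ℚ.- seq y n)))
  , (λ ε 0<ε → let M , close = x≈y ε 0<ε in M , λ n M≤n →
      ℚ.neg-antimono-≤ (ℚ.≤-trans (p≤∣p∣ (seq x n ℚ.- seq y n)) (ℚ.<⇒≤ (close n M≤n))))
  where
  p≤∣p∣ : ∀ p → p ℚ.≤ ℚ.∣ p ∣
  p≤∣p∣ p with ℚ.≤-total 0ℚ p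
  ... | inj₁ 0≤p = ℚ.≤-reflexive (sym (ℚ.0≤p⇒∣p∣≡p 0≤p))
  ... | inj₂ p≤0 = ℚ.≤-trans p≤0 (ℚ.0≤∣p∣ p)

  -∣p∣≤p : ∀ p → ℚ.- ℚ.∣ p ∣ ℚ.≤ p
  -∣p∣≤p p = subst₂ (λ r s → ℚ.- r ℚ.≤ s) (ℚ.∣-p∣≡∣p∣ p) (⁻¹-involutive p)
    (ℚ.neg-antimono-≤ (p≤∣p∣ (ℚ.- p)))
    where open AbelianGroupProperties ℚ.+-0-abelianGroup

rationalPoints : ∀ {n} → Vector ℚ n → Vector ℚ n → Vector (Point 2) n
rationalPoints X Y i zero    = fromℚ (X i)
rationalPoints X Y i (suc _) = fromℚ (Y i)

-- Up to null sequences, the value of the form at q is the weighted sum of its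
-- values at the points.
conv-affine : ∀ {n} {q} {X Y : Vector ℚ n} {S} →
  q ∈conv[ rationalPoints X Y , S ] →
  ∀ α β γ → (∀ i → i ∈ S → 0ℚ ℚ.≤ α ℚ.* X i ℚ.+ β ℚ.* Y i ℚ.+ γ) →
  EventuallyNonNegative (λ k → α ℚ.* seq (q zero) k ℚ.+ β ℚ.* seq (q (suc zero)) k ℚ.+ γ)
conv-affine {n} {q} {X} {Y} {S} q∈ α β γ g≥0 = nonNegative-cong regroup
  (nonNegative-+ (nonNegative-+ (nonNegative-+
    (nonNegative-null-* (ℚ.- α) (≈⇒null (combination weight P zero) (q zero) (combines zero)))
    (nonNegative-null-* (ℚ.- β) (≈⇒null (combination weight P (suc zero)) (q (suc zero)) (combines (suc zero)))))
    (nonNegative-null-* (ℚ.- γ) (≈⇒null (sum weight) 1ℝ sum-one)))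
    (nonNegative-sum term))
  where
  open _∈conv[_,_] q∈
  P : Vector (Point 2) n
  P = rationalPoints X Y
  g : Vector ℚ n
  g i = α ℚ.* X i ℚ.+ β ℚ.* Y i ℚ.+ γ

  term : ∀ i → EventuallyNonNegative (λ k → g i ℚ.* seq (weight i) k)
  -- Outside `S` nothing is known about the sign of `g i`, but the weight is null there.
  term i with i ∈? S
  ... | yes i∈S = nonNegative-* (g≥0 i i∈S) (≤⇒nonNegative {weight i} (nonNegative i))
  ... | no  i∉S = nonNegative-null-* (g i)
    (subst-null (≈⇒null (weight i) 0ℝ (supported i∉S)))
    where
    subst-null : Null (λ k → seq (weight i) k ℚ.- 0ℚ) → Null (seq (weight i))
    subst-null (≥0 , ≤0) =
        nonNegative-cong (λ k → ℚ.+-identityʳ (seq (weight i) k)) ≥0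
      , nonNegative-cong (λ k → cong ℚ.-_ (ℚ.+-identityʳ (seq (weight i) k))) ≤0

  open ≡-Reasoning
  open ℚSolver.+-*-Solver

  sum-g : ∀ k → sumℚ (λ i → g i ℚ.* seq (weight i) k) ≡
    α ℚ.* sumℚ (λ i → seq (weight i) k ℚ.* X i) ℚ.+
    β ℚ.* sumℚ (λ i → seq (weight i) k ℚ.* Y i) ℚ.+ γ ℚ.* sumℚ (λ i → seq (weight i) k)
  sum-g k = begin
    sumℚ (λ i → g i ℚ.* w i)
      ≡⟨ sumℚ-cong (λ i → distribute (X i) (Y i) (w i)) ⟩
    sumℚ (λ i → (α ℚ.* (w i ℚ.* X i) ℚ.+ β ℚ.* (w i ℚ.* Y i)) ℚ.+ γ ℚ.* w i)
      ≡⟨ sumℚ-+ (λ i → α ℚ.* (w i ℚ.* X i) ℚ.+ β ℚ.* (w i ℚ.* Y i)) (λ i → γ ℚ.* w i) ⟩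
    sumℚ (λ i → α ℚ.* (w i ℚ.* X i) ℚ.+ β ℚ.* (w i ℚ.* Y i)) ℚ.+ sumℚ (λ i → γ ℚ.* w i)
      ≡⟨ cong (ℚ._+ sumℚ (λ i → γ ℚ.* w i))
           (sumℚ-+ (λ i → α ℚ.* (w i ℚ.* X i)) (λ i → β ℚ.* (w i ℚ.* Y i))) ⟩
    sumℚ (λ i → α ℚ.* (w i ℚ.* X i)) ℚ.+ sumℚ (λ i → β ℚ.* (w i ℚ.* Y i)) ℚ.+ sumℚ (λ i → γ ℚ.* w i)
      ≡⟨ cong₂ ℚ._+_ (cong₂ ℚ._+_
           (*-distribˡ-sumℚ α (λ i → w i ℚ.* X i)) (*-distribˡ-sumℚ β (λ i → w i ℚ.* Y i)))
           (*-distribˡ-sumℚ γ w) ⟨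
    α ℚ.* sumℚ (λ i → w i ℚ.* X i) ℚ.+ β ℚ.* sumℚ (λ i → w i ℚ.* Y i) ℚ.+ γ ℚ.* sumℚ w ∎
    where
    w : Vector ℚ n
    w i = seq (weight i) k
    distribute : ∀ x y v → (α ℚ.* x ℚ.+ β ℚ.* y ℚ.+ γ) ℚ.* v ≡
      (α ℚ.* (v ℚ.* x) ℚ.+ β ℚ.* (v ℚ.* y)) ℚ.+ γ ℚ.* v
    distribute = solve 6 (λ α β γ x y v → (α :* x :+ β :* y :+ γ) :* v :=
      (α :* (v :* x) :+ β :* (v :* y)) :+ γ :* v) refl α β γ

  regroup : ∀ k →
    ((ℚ.- α ℚ.* (seq (combination weight P zero) k ℚ.- seq (q zero) k) ℚ.+
      ℚ.- β ℚ.* (seq (combination weight P (suc zero)) k ℚ.- seq (q (suc zero)) k)) ℚ.+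
      ℚ.- γ ℚ.* (seq (sum weight) k ℚ.- 1ℚ)) ℚ.+ sumℚ (λ i → g i ℚ.* seq (weight i) k)
    ≡ α ℚ.* seq (q zero) k ℚ.+ β ℚ.* seq (q (suc zero)) k ℚ.+ γ
  regroup k = trans
    (cong₂ ℚ._+_
      (cong₂ ℚ._+_
        (cong₂ ℚ._+_
          (cong (λ z → ℚ.- α ℚ.* (z ℚ.- seq (q zero) k))
            (seq-sum (λ i → weight i ℝ.* P i zero) k))
          (cong (λ z → ℚ.- β ℚ.* (z ℚ.- seq (q (suc zero)) k))
            (seq-sum (λ i → weight i ℝ.* P i (suc zero)) k)))
        (cong (λ z → ℚ.- γ ℚ.* (z ℚ.- 1ℚ)) (seq-sum weight k)))
      (sum-g k))
    (cancel α β γ (seq (q zero) k) (seq (q (suc zero)) k)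
      (sumℚ (λ i → seq (weight i) k ℚ.* X i)) (sumℚ (λ i → seq (weight i) k ℚ.* Y i))
      (sumℚ (λ i → seq (weight i) k)))
    where
    cancel : ∀ α β γ x y a b s →
      ((ℚ.- α ℚ.* (a ℚ.- x) ℚ.+ ℚ.- β ℚ.* (b ℚ.- y)) ℚ.+ ℚ.- γ ℚ.* (s ℚ.- 1ℚ)) ℚ.+
        (α ℚ.* a ℚ.+ β ℚ.* b ℚ.+ γ ℚ.* s) ≡ α ℚ.* x ℚ.+ β ℚ.* y ℚ.+ γ
    cancel = solve 8 (λ α β γ x y a b s →
      ((:- α :* (a :- x) :+ :- β :* (b :- y)) :+ :- γ :* (s :- con 1ℚ)) :+
        (α :* a :+ β :* b :+ γ :* s) := α :* x :+ β :* y :+ γ) refl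

ι-affine : ∀ α β γ x y →
  ι (α ℤ.* x ℤ.+ β ℤ.* y ℤ.+ γ) ≡ ι α ℚ.* ι x ℚ.+ ι β ℚ.* ι y ℚ.+ ι γ
ι-affine α β γ x y = trans (ι-homo-+ (α ℤ.* x ℤ.+ β ℤ.* y) γ) (cong (ℚ._+ ι γ)
  (trans (ι-homo-+ (α ℤ.* x) (β ℤ.* y)) (cong₂ ℚ._+_ (ι-homo-* α x) (ι-homo-* β y))))

-- Over the integers the form `g` is at least 1 on `T`. At a common point `q` both `- g` and `g - 1`
-- would be eventually nonnegative, whereas their sum is constantly -1; tolerance ½ already exposes
-- this.
separated-hulls-disjoint : ∀ {n} {q} {X Y : Vector ℤ n} {S T} α β γ →
  (∀ i → i ∈ S → α ℤ.* X i ℤ.+ β ℤ.* Y i ℤ.+ γ ℤ.≤ 0ℤ) →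
  (∀ i → i ∈ T → 0ℤ ℤ.< α ℤ.* X i ℤ.+ β ℤ.* Y i ℤ.+ γ) →
  q ∈conv[ rationalPoints (ι ∘ X) (ι ∘ Y) , S ] →
  ¬ (q ∈conv[ rationalPoints (ι ∘ X) (ι ∘ Y) , T ])
separated-hulls-disjoint {q = q} {X} {Y} α β γ g≤0 g>0 q∈S q∈T =
  let M , bound = nonNegative-cong sum≡-1 (nonNegative-+
        (conv-affine q∈S (ℚ.- ι α) (ℚ.- ι β) (ℚ.- ι γ) -g≥0)
        (conv-affine q∈T (ι α) (ι β) (ι γ ℚ.- 1ℚ) g-1≥0)) ½ (ℚ.positive⁻¹ ½)
  in contradiction (bound M ℕ.≤-refl) (from-no (ℚ.- ½ ℚ.≤? ℚ.- 1ℚ))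
  where
  open ℚSolver.+-*-Solver
  -g≥0 : ∀ i → i ∈ _ →
    0ℚ ℚ.≤ ℚ.- ι α ℚ.* ι (X i) ℚ.+ ℚ.- ι β ℚ.* ι (Y i) ℚ.+ ℚ.- ι γ
  -g≥0 i i∈S = subst (0ℚ ℚ.≤_)
    (trans (cong ℚ.-_ (ι-affine α β γ (X i) (Y i)))
      (negate (ι α) (ι β) (ι γ) (ι (X i)) (ι (Y i))))
    (ℚ.neg-antimono-≤ (ι-mono-≤ (g≤0 i i∈S)))
    where
    negate : ∀ a b c x y → ℚ.- (a ℚ.* x ℚ.+ b ℚ.* y ℚ.+ c) ≡
      ℚ.- a ℚ.* x ℚ.+ ℚ.- b ℚ.* y ℚ.+ ℚ.- c
    negate = solve 5 (λ a b c x y →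
      :- (a :* x :+ b :* y :+ c) := :- a :* x :+ :- b :* y :+ :- c) refl
  g-1≥0 : ∀ i → i ∈ _ →
    0ℚ ℚ.≤ ι α ℚ.* ι (X i) ℚ.+ ι β ℚ.* ι (Y i) ℚ.+ (ι γ ℚ.- 1ℚ)
  g-1≥0 i i∈T = subst (0ℚ ℚ.≤_)
    (trans (cong (ℚ._- 1ℚ) (ι-affine α β γ (X i) (Y i)))
      (ℚ.+-assoc (ι α ℚ.* ι (X i) ℚ.+ ι β ℚ.* ι (Y i)) (ι γ) (ℚ.- 1ℚ)))
    (ℚ.+-monoˡ-≤ (ℚ.- 1ℚ) (ι-mono-≤ (ℤ.i<j⇒suc[i]≤j (g>0 i i∈T))))
  sum≡-1 : ∀ k →
    (ℚ.- ι α ℚ.* seq (q zero) k ℚ.+ ℚ.- ι β ℚ.* seq (q (suc zero)) k ℚ.+ ℚ.- ι γ) ℚ.+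
    (ι α ℚ.* seq (q zero) k ℚ.+ ι β ℚ.* seq (q (suc zero)) k ℚ.+ (ι γ ℚ.- 1ℚ)) ≡ ℚ.- 1ℚ
  sum≡-1 k = cancel (ι α) (ι β) (ι γ) (seq (q zero) k) (seq (q (suc zero)) k)
    where
    cancel : ∀ a b c x y → (ℚ.- a ℚ.* x ℚ.+ ℚ.- b ℚ.* y ℚ.+ ℚ.- c) ℚ.+
      (a ℚ.* x ℚ.+ b ℚ.* y ℚ.+ (c ℚ.- 1ℚ)) ≡ ℚ.- 1ℚ
    cancel = solve 5 (λ a b c x y →
      (:- a :* x :+ :- b :* y :+ :- c) :+ (a :* x :+ b :* y :+ (c :- con 1ℚ)) := :- con 1ℚ) refl

-- Counting in finite sets

∣p∩q∣+∣p─q∣≡∣p∣ : ∀ {n} (p q : Subset n) → ∣ p ∩ q ∣ + ∣ p ─ q ∣ ≡ ∣ p ∣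
∣p∩q∣+∣p─q∣≡∣p∣ [] [] = refl
∣p∩q∣+∣p─q∣≡∣p∣ (inside  ∷ p) (inside  ∷ q) = cong suc (∣p∩q∣+∣p─q∣≡∣p∣ p q)
∣p∩q∣+∣p─q∣≡∣p∣ (inside  ∷ p) (outside ∷ q) =
  trans (ℕ.+-suc ∣ p ∩ q ∣ ∣ p ─ q ∣) (cong suc (∣p∩q∣+∣p─q∣≡∣p∣ p q))
∣p∩q∣+∣p─q∣≡∣p∣ (outside ∷ p) (inside  ∷ q) = ∣p∩q∣+∣p─q∣≡∣p∣ p q
∣p∩q∣+∣p─q∣≡∣p∣ (outside ∷ p) (outside ∷ q) = ∣p∩q∣+∣p─q∣≡∣p∣ p q

x∈p─q⇒x∉q : ∀ {n x} (p q : Subset n) → x ∈ p ─ q → x ∉ q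
x∈p─q⇒x∉q (_ ∷ p) (inside  ∷ q) (there x∈p─q) (there x∈q) = x∈p─q⇒x∉q p q x∈p─q x∈q
x∈p─q⇒x∉q (_ ∷ p) (outside ∷ q) (there x∈p─q) (there x∈q) = x∈p─q⇒x∉q p q x∈p─q x∈q

open CommutativeMonoidSum ℕ.+-0-commutativeMonoid using ()
  renaming (sum to sumℕ; ∑-distrib-+ to sumℕ-+)

sumℕ-disjoint≤ : ∀ {n k} (parts : Vector (Subset n) k) (S : Subset n) →
  (∀ {i j} → i ≢ j → Empty (parts i ∩ parts j)) → (∀ i → parts i ⊆ S) →
  sumℕ (λ i → ∣ parts i ∣) ≤ ∣ S ∣
sumℕ-disjoint≤ {k = zero}  parts S _ _ = z≤n
sumℕ-disjoint≤ {k = suc k} parts S disjoint parts⊆S = begin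
  ∣ parts zero ∣ + sumℕ (λ i → ∣ parts (suc i) ∣)
    ≤⟨ ℕ.+-mono-≤
         (p⊆q⇒∣p∣≤∣q∣ (λ x∈p → x∈p∩q⁺ (parts⊆S zero x∈p , x∈p)))
         (sumℕ-disjoint≤ (parts ∘ suc) (S ─ parts zero) (λ i≢j → disjoint (i≢j ∘ Fin.suc-injective))
           λ i x∈p → x∈p∧x∉q⇒x∈p─q (parts⊆S (suc i) x∈p)
             λ x∈p₀ → disjoint {suc i} {zero} (λ ()) (_ , x∈p∩q⁺ (x∈p , x∈p₀))) ⟩
  ∣ S ∩ parts zero ∣ + ∣ S ─ parts zero ∣
    ≡⟨ ∣p∩q∣+∣p─q∣≡∣p∣ S (parts zero) ⟩
  ∣ S ∣ ∎
  where open ℕ.≤-Reasoning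

*≤sumℕ : ∀ {k} (f : Vector ℕ k) b → (∀ i → b ≤ f i) → k * b ≤ sumℕ f
*≤sumℕ {zero}  f b b≤f = z≤n
*≤sumℕ {suc k} f b b≤f = ℕ.+-mono-≤ (b≤f zero) (*≤sumℕ (f ∘ suc) b (b≤f ∘ suc))

-- In the configuration below, `from m` consists of the indices of the deep points.
from : ∀ {n} → ℕ → Subset n
from {zero}  m       = []
from {suc n} zero    = inside ∷ from zero
from {suc n} (suc m) = outside ∷ from m

∣from∣≤ : ∀ {n c} m → n ≤ m + c → ∣ from {n} m ∣ ≤ c
∣from∣≤ {zero}  m       _            = z≤n
∣from∣≤ {suc n} {suc c} zero (s≤s n≤c) = s≤s (∣from∣≤ zero n≤c)
∣from∣≤ {suc n} (suc m) (s≤s n≤m+c)  = ∣from∣≤ m n≤m+c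

∈-from : ∀ {n} m (i : Fin n) → m ≤ toℕ i → i ∈ from m
∈-from zero    zero    _         = here
∈-from zero    (suc i) _         = there (∈-from zero i z≤n)
∈-from (suc m) (suc i) (s≤s m≤i) = there (∈-from m i m≤i)

nonempty⇒∣p∣>0 : ∀ {n} {p : Subset n} → Nonempty p → 0 < ∣ p ∣
nonempty⇒∣p∣>0 (x , x∈p) = ℕ.≤-<-trans z≤n (x∈p⇒∣p-x∣<∣p∣ x∈p)

-- The witnesses are the least and the greatest element, which are `∣ S ∣ - 1` gaps apart. The last
-- `+ k` replaces this subtraction; for a singleton the witnesses coincide.
spread : ∀ {n} k (S : Subset n) → Nonempty S →
  (∀ {a b} → a ∈ S → b ∈ S → a Fin.< b → toℕ a + k ≤ toℕ b) →
  ∃[ a ] ∃[ b ] a ∈ S × b ∈ S × toℕ a + k * ∣ S ∣ ≤ toℕ b + k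
spread k (outside ∷ S) (suc x , there x∈S) gaps
  with spread k S (x , x∈S) (λ a∈S b∈S a<b → ℕ.≤-pred (gaps (there a∈S) (there b∈S) (s≤s a<b)))
... | a , b , a∈S , b∈S , a+k∣S∣≤b+k = suc a , suc b , there a∈S , there b∈S , s≤s a+k∣S∣≤b+k
spread {suc n} k (inside ∷ S) _ gaps with nonempty? S
... | no S-empty = zero , zero , here , here , ℕ.≤-reflexive
    (trans (cong (λ p → k * suc ∣ p ∣) (Empty-unique S-empty))
      (trans (cong (λ z → k * suc z) (∣⊥∣≡0 n)) (ℕ.*-identityʳ k)))
... | yes S-nonempty
  with spread k S S-nonempty (λ a∈S b∈S a<b → ℕ.≤-pred (gaps (there a∈S) (there b∈S) (s≤s a<b)))
... | a , b , a∈S , b∈S , a+k∣S∣≤b+k = zero , suc b , here , there b∈S , (begin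
  k * suc ∣ S ∣            ≡⟨ ℕ.*-suc k ∣ S ∣ ⟩
  k + k * ∣ S ∣          ≤⟨ ℕ.+-monoˡ-≤ (k * ∣ S ∣) (gaps here (there a∈S) (s≤s z≤n)) ⟩
  suc (toℕ a + k * ∣ S ∣) ≤⟨ s≤s a+k∣S∣≤b+k ⟩
  suc (toℕ b + k)          ∎)
  where open ℕ.≤-Reasoning

injective-in-interval : ∀ {k a d} (f : Fin k → ℕ) → (∀ {i j} → f i ≡ f j → i ≡ j) →
  (∀ i → a ≤ f i) → (∀ i → f i < a + d) → k ≤ d
injective-in-interval {a = a} {d} f f-injective a≤f f<a+d =
  Fin.injective⇒≤ {f = λ i → fromℕ< (f∸a<d i)}
    λ {i} {j} eq → f-injective (ℕ.∸-cancelʳ-≡ (a≤f i) (a≤f j) (Fin.fromℕ<-injective _ _ (f∸a<d i) (f∸a<d j) eq))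
  where
  f∸a<d : ∀ i → f i ∸ a < d
  f∸a<d i = ℕ.m<n+o⇒m∸n<o (f i) a {d} {{ℕ.>-nonZero 0<d}} (f<a+d i)
    where
    0<d : 0 < d
    0<d = ℕ.+-cancelˡ-< a 0 d (ℕ.≤-<-trans (ℕ.≤-reflexive (ℕ.+-identityʳ a)) (ℕ.≤-<-trans (a≤f i) (f<a+d i)))

-- Disjoint parts supply different representatives, so pigeonhole applies to their images in an
-- interval of length `d`. As `φ` sees the proof of `Q x`, it can place a point by cases, which is
-- how a cyclic interval gets unrolled later.
transversal-bound : ∀ {n k a d} {parts : Vector (Subset n) k} →
  (∀ {i j} → i ≢ j → Empty (parts i ∩ parts j)) →
  {Q : Fin n → Set} (φ : ∀ {x} → Q x → ℕ) →
  (∀ {x y} (qx : Q x) (qy : Q y) → φ qx ≡ φ qy → x ≡ y) →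
  (∀ {x} (qx : Q x) → a ≤ φ qx × φ qx < a + d) →
  (∀ i → ∃[ x ] x ∈ parts i × Q x) → k ≤ d
transversal-bound {parts = parts} disjoint φ φ-injective bounds hit = injective-in-interval
  (λ i → φ (proj₂ (proj₂ (hit i))))
  (λ {i} {j} eq → decidable-stable (i Fin.≟ j) λ i≢j → disjoint i≢j
    (proj₁ (hit i) , x∈p∩q⁺
      (proj₁ (proj₂ (hit i)) ,
       subst (_∈ parts j) (sym (φ-injective (proj₂ (proj₂ (hit i))) (proj₂ (proj₂ (hit j))) eq)) (proj₁ (proj₂ (hit j))))))
  (λ i → proj₁ (bounds (proj₂ (proj₂ (hit i)))))
  (λ i → proj₂ (bounds (proj₂ (proj₂ (hit i)))))

-- Delete `parts A ─ K`: the rest of `A` lies in the closed half-plane, and `B` loses nothing that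
-- could help it. If all of `B` were on the open opposite side, the two remaining hulls would be
-- disjoint. The search for a point of `B` is finite, so the witness is found constructively.
crossing : ∀ {n k t} (x y : Vector ℤ n) {parts : Vector (Subset n) k} →
  IsTolerant t (rationalPoints (ι ∘ x) (ι ∘ y)) parts →
  (∀ {i j} → i ≢ j → Empty (parts i ∩ parts j)) →
  ∀ {A B} → A ≢ B → ∀ K → ∣ parts A ─ K ∣ ≤ t → ∀ α β γ →
  (∀ i → i ∈ parts A → i ∈ K → α ℤ.* x i ℤ.+ β ℤ.* y i ℤ.+ γ ℤ.≤ 0ℤ) →
  ∃[ i ] i ∈ parts B × α ℤ.* x i ℤ.+ β ℤ.* y i ℤ.+ γ ℤ.≤ 0ℤ
crossing x y {parts} tolerant disjoint {A} {B} A≢B K ∣A─K∣≤t α β γ g≤0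
  with Fin.any? (λ i → i ∈? parts B ×-dec (α ℤ.* x i ℤ.+ β ℤ.* y i ℤ.+ γ ℤ.≤? 0ℤ))
... | yes hit = hit
... | no  miss with tolerant (parts A ─ K) ∣A─K∣≤t
... | q , q∈ = contradiction (q∈ B) (separated-hulls-disjoint α β γ
  (λ i i∈ → g≤0 i (p─q⊆p (parts A) (parts A ─ K) i∈)
    (decidable-stable (i ∈? K) λ i∉K → x∈p─q⇒x∉q (parts A) (parts A ─ K) i∈
      (x∈p∧x∉q⇒x∈p─q (p─q⊆p (parts A) (parts A ─ K) i∈) i∉K)))
  (λ i i∈ → ℤ.≰⇒> λ g≤0 → miss (i , p─q⊆p (parts B) (parts A ─ K) i∈ , g≤0))
  (q∈ A))

-- The configuration of points

-- The affine form vanishing at the points (2p, 4p²) for p = a and p = b.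
slope intercept : ℕ → ℕ → ℤ
slope     a b = ℤ.- (+ 2 ℤ.* (+ a ℤ.+ + b))
intercept a b = + 4 ℤ.* + a ℤ.* + b

height : ℕ → ℕ → ℤ → ℤ → ℤ
height a b x y = slope a b ℤ.* x ℤ.+ 1ℤ ℤ.* y ℤ.+ intercept a b

-- The negative of `height`, expanded into the shape `α x + β y + γ` that `crossing` expects.
depth : ℕ → ℕ → ℤ → ℤ → ℤ
depth a b x y = ℤ.- slope a b ℤ.* x ℤ.+ ℤ.- 1ℤ ℤ.* y ℤ.+ ℤ.- intercept a b

depth-height : ∀ a b x y → depth a b x y ≡ ℤ.- height a b x y
depth-height a b x y = lemma (slope a b) (intercept a b) x y
  where
  lemma : ∀ s i x y → ℤ.- s ℤ.* x ℤ.+ ℤ.- 1ℤ ℤ.* y ℤ.+ ℤ.- i ≡ ℤ.- (s ℤ.* x ℤ.+ 1ℤ ℤ.* y ℤ.+ i)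
  lemma = solve-∀

height-parabola : ∀ a b p → height a b (+ 2 ℤ.* + p) (+ 4 ℤ.* + p ℤ.* + p) ≡
  + 4 ℤ.* (+ p ℤ.- + a) ℤ.* (+ p ℤ.- + b)
height-parabola a b p = lemma (+ a) (+ b) (+ p)
  where
  lemma : ∀ a b p → ℤ.- (+ 2 ℤ.* (a ℤ.+ b)) ℤ.* (+ 2 ℤ.* p) ℤ.+ 1ℤ ℤ.* (+ 4 ℤ.* p ℤ.* p) ℤ.+ + 4 ℤ.* a ℤ.* b ≡
    + 4 ℤ.* (p ℤ.- a) ℤ.* (p ℤ.- b)
  lemma = solve-∀

-- For p < a ≤ b the gaps are written as a = p + 1 + d and b = p + 1 + d + e.
0<height-left : ∀ {a b p} → p < a → a ≤ b →
  0ℤ ℤ.< height a b (+ 2 ℤ.* + p) (+ 4 ℤ.* + p ℤ.* + p)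
0<height-left {a} {b} {p} p<a a≤b with ℕ.m≤n⇒∃[o]m+o≡n p<a | ℕ.m≤n⇒∃[o]m+o≡n a≤b
... | d , refl | e , refl = subst (0ℤ ℤ.<_)
    (sym (trans (height-parabola a b p) (lemma (+ p) (+ d) (+ e))))
    (ℤ.+<+ (s≤s z≤n))
  where
  lemma : ∀ p d e → + 4 ℤ.* (p ℤ.- (1ℤ ℤ.+ p ℤ.+ d)) ℤ.* (p ℤ.- (1ℤ ℤ.+ p ℤ.+ d ℤ.+ e)) ≡
    + 4 ℤ.* ((1ℤ ℤ.+ d) ℤ.* (1ℤ ℤ.+ d ℤ.+ e))
  lemma = solve-∀

0<height-right : ∀ {a b p} → a ≤ b → b < p →
  0ℤ ℤ.< height a b (+ 2 ℤ.* + p) (+ 4 ℤ.* + p ℤ.* + p)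
0<height-right {a} {b} {p} a≤b b<p with ℕ.m≤n⇒∃[o]m+o≡n a≤b | ℕ.m≤n⇒∃[o]m+o≡n b<p
... | d , refl | e , refl = subst (0ℤ ℤ.<_)
    (sym (trans (height-parabola a b p) (lemma (+ a) (+ d) (+ e))))
    (ℤ.+<+ (s≤s z≤n))
  where
  lemma : ∀ a d e → + 4 ℤ.* ((1ℤ ℤ.+ (a ℤ.+ d) ℤ.+ e) ℤ.- a) ℤ.* ((1ℤ ℤ.+ (a ℤ.+ d) ℤ.+ e) ℤ.- (a ℤ.+ d)) ≡
    + 4 ℤ.* ((1ℤ ℤ.+ (d ℤ.+ e)) ℤ.* (1ℤ ℤ.+ e))
  lemma = solve-∀

0<depth-between : ∀ {a b p} → a < p → p < b →
  0ℤ ℤ.< depth a b (+ 2 ℤ.* + p) (+ 4 ℤ.* + p ℤ.* + p)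
0<depth-between {a} {b} {p} a<p p<b with ℕ.m≤n⇒∃[o]m+o≡n a<p | ℕ.m≤n⇒∃[o]m+o≡n p<b
... | d , refl | e , refl = subst (0ℤ ℤ.<_)
    (sym (trans (depth-height a b (+ 2 ℤ.* + p) _) (trans (cong ℤ.-_ (height-parabola a b p)) (lemma (+ a) (+ d) (+ e)))))
    (ℤ.+<+ (s≤s z≤n))
  where
  lemma : ∀ a d e → ℤ.- (+ 4 ℤ.* ((1ℤ ℤ.+ a ℤ.+ d) ℤ.- a) ℤ.*
      ((1ℤ ℤ.+ a ℤ.+ d) ℤ.- (1ℤ ℤ.+ (1ℤ ℤ.+ a ℤ.+ d) ℤ.+ e))) ≡
    + 4 ℤ.* ((1ℤ ℤ.+ d) ℤ.* (1ℤ ℤ.+ e))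
  lemma = solve-∀

height-end : ∀ a b → height a b (+ 2 ℤ.* + a) (+ 4 ℤ.* + a ℤ.* + a) ≡ 0ℤ
height-end a b = trans (height-parabola a b a) (lemma (+ a) (+ b))
  where
  lemma : ∀ a b → + 4 ℤ.* (a ℤ.- a) ℤ.* (a ℤ.- b) ≡ 0ℤ
  lemma = solve-∀

height-endʳ : ∀ a b → height a b (+ 2 ℤ.* + b) (+ 4 ℤ.* + b ℤ.* + b) ≡ 0ℤ
height-endʳ a b = trans (height-parabola a b b) (lemma (+ a) (+ b))
  where
  lemma : ∀ a b → + 4 ℤ.* (b ℤ.- a) ℤ.* (b ℤ.- b) ≡ 0ℤ
  lemma = solve-∀

0≤i*i : ∀ i → 0ℤ ℤ.≤ i ℤ.* i
0≤i*i (+ n)    = subst (0ℤ ℤ.≤_) (ℤ.pos-* n n) (ℤ.+≤+ z≤n)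
0≤i*i -[1+ n ] = ℤ.+≤+ z≤n

-- With k = b − a + 1 + e the height is a square plus positive terms.
0<height-centre : ∀ {k a b} j → a ≤ b → b < a + k →
  0ℤ ℤ.< height a b (+ 3 ℤ.* + k) (+ 10 ℤ.* + k ℤ.* + k ℤ.+ + j)
0<height-centre {k} {a} j a≤b b<a+k with ℕ.m≤n⇒∃[o]m+o≡n a≤b
... | d , refl with ℕ.m≤n⇒∃[o]m+o≡n (ℕ.+-cancelˡ-< a d k b<a+k)
... | e , refl = subst (0ℤ ℤ.<_) (sym (lemma (+ a) (+ d) (+ e) (+ j)))
    (ℤ.+-mono-≤-< {0ℤ} {_} {0ℤ} (0≤i*i (+ 3 ℤ.* (1ℤ ℤ.+ + d ℤ.+ + e) ℤ.- + 2 ℤ.* + a ℤ.- + d))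
      (ℤ.+<+ (s≤s z≤n)))
  where
  lemma : ∀ a d e j →
    ℤ.- (+ 2 ℤ.* (a ℤ.+ (a ℤ.+ d))) ℤ.* (+ 3 ℤ.* (1ℤ ℤ.+ d ℤ.+ e)) ℤ.+
      1ℤ ℤ.* (+ 10 ℤ.* (1ℤ ℤ.+ d ℤ.+ e) ℤ.* (1ℤ ℤ.+ d ℤ.+ e) ℤ.+ j) ℤ.+ + 4 ℤ.* a ℤ.* (a ℤ.+ d) ≡
    (+ 3 ℤ.* (1ℤ ℤ.+ d ℤ.+ e) ℤ.- + 2 ℤ.* a ℤ.- d) ℤ.* (+ 3 ℤ.* (1ℤ ℤ.+ d ℤ.+ e) ℤ.- + 2 ℤ.* a ℤ.- d) ℤ.+
    ((1ℤ ℤ.+ e) ℤ.* (1ℤ ℤ.+ e ℤ.+ (d ℤ.+ d)) ℤ.+ j)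
  lemma = solve-∀

-- The depth is affine in `b` with leading coefficient `6k - 4a > 0`, hence least at `b = a + 2k`,
-- where it is `2k² + 4a(k - a) - j`. The ordinate `10k²` is `k²` above the parabola at abscissa
-- `3k`: enough to clear every chord with `b - a < k`, yet below the long chords considered here.
0<depth-centre : ∀ {k a b j} → suc a < k → a + (k + k) ≤ b → j < k →
  0ℤ ℤ.< depth a b (+ 3 ℤ.* + k) (+ 10 ℤ.* + k ℤ.* + k ℤ.+ + j)
0<depth-centre {k} {a} {b} {j} 1+a<k a+2k≤b j<k
  with ℕ.m≤n⇒∃[o]m+o≡n 1+a<k | ℕ.m≤n⇒∃[o]m+o≡n a+2k≤b
... | e , refl | f , refl = subst (0ℤ ℤ.<_)
    (sym (trans (depth-height a b (+ 3 ℤ.* + k) _) (lemma (+ a) (+ e) (+ f) (+ j))))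
    (ℤ.+-mono-<-≤ {0ℤ} {_} {0ℤ}
      -- Strictness comes from the offset `j` being smaller than `k`.
      (subst (ℤ._< + k ℤ.- + j) (ℤ.+-inverseʳ (+ j)) (ℤ.+-monoˡ-< (ℤ.- + j) (ℤ.+<+ j<k)))
      (subst (0ℤ ℤ.≤_) (cong (λ z → + k ℤ.+ (+ k ℤ.+ + k) ℤ.* (1ℤ ℤ.+ + a ℤ.+ + e ℤ.+ + f) ℤ.+ z)
        (ℤ.pos-* (4 * (2 + e)) (a + f))) (ℤ.+≤+ z≤n)))
  where
  lemma : ∀ a e f j → let k = 1ℤ ℤ.+ (1ℤ ℤ.+ a) ℤ.+ e; b = a ℤ.+ (k ℤ.+ k) ℤ.+ f in
    ℤ.- (ℤ.- (+ 2 ℤ.* (a ℤ.+ b)) ℤ.* (+ 3 ℤ.* k) ℤ.+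
      1ℤ ℤ.* (+ 10 ℤ.* k ℤ.* k ℤ.+ j) ℤ.+ + 4 ℤ.* a ℤ.* b) ≡
    (k ℤ.- j) ℤ.+ (k ℤ.+ (k ℤ.+ k) ℤ.* (1ℤ ℤ.+ a ℤ.+ e ℤ.+ f) ℤ.+
      (+ 4 ℤ.* (+ 2 ℤ.+ e)) ℤ.* (a ℤ.+ f))
  lemma = solve-∀

-- For p ≥ m the points lie high on the vertical line through the middle of
-- the parabolic arc.
abscissa ordinate : (k m p : ℕ) → ℤ
abscissa k m p with p ℕ.<? m
... | yes _ = + 2 ℤ.* + p
... | no  _ = + 3 ℤ.* + k
ordinate k m p with p ℕ.<? m
... | yes _ = + 4 ℤ.* + p ℤ.* + p
... | no  _ = + 10 ℤ.* + k ℤ.* + k ℤ.+ + (p ∸ m)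

height-end≤0 : ∀ {k m p} a b → p < m → p ≡ a ⊎ p ≡ b →
  height a b (abscissa k m p) (ordinate k m p) ℤ.≤ 0ℤ
height-end≤0 {m = m} {p} a b p<m end with p ℕ.<? m | end
... | yes _   | inj₁ refl = ℤ.≤-reflexive (height-end a b)
... | yes _   | inj₂ refl = ℤ.≤-reflexive (height-endʳ a b)
... | no  p≮m | _         = contradiction p<m p≮m

depth-end≤0 : ∀ {k m p} a b → p < m → p ≡ a ⊎ p ≡ b →
  depth a b (abscissa k m p) (ordinate k m p) ℤ.≤ 0ℤ
depth-end≤0 {m = m} {p} a b p<m end with p ℕ.<? m | end
... | yes _   | inj₁ refl = ℤ.≤-reflexive (trans (depth-height a b (+ 2 ℤ.* + a) _) (cong ℤ.-_ (height-end a b)))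
... | yes _   | inj₂ refl = ℤ.≤-reflexive (trans (depth-height a b (+ 2 ℤ.* + b) _) (cong ℤ.-_ (height-endʳ a b)))
... | no  p≮m | _         = contradiction p<m p≮m

-- Deep points are excluded because the chord is short. For `a ≡ b` the chord becomes the tangent at
-- `a`, which then meets no point but its own.
height≤0⇒between : ∀ {k m a b p} → a ≤ b → b < a + k →
  height a b (abscissa k m p) (ordinate k m p) ℤ.≤ 0ℤ →
  p < m × a ≤ p × p ≤ b
height≤0⇒between {m = m} {p = p} a≤b b<a+k h≤0 with p ℕ.<? m
... | yes p<m = p<m , ℕ.≮⇒≥ (λ p<a → ℤ.<⇒≱ (0<height-left p<a a≤b) h≤0)
                    , ℕ.≮⇒≥ (λ b<p → ℤ.<⇒≱ (0<height-right a≤b b<p) h≤0)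
... | no  _   = contradiction h≤0 (ℤ.<⇒≱ (0<height-centre (p ∸ m) a≤b b<a+k))

depth≤0⇒outside : ∀ {k m a b p} → suc a < k → a + (k + k) ≤ b → p ∸ m < k →
  depth a b (abscissa k m p) (ordinate k m p) ℤ.≤ 0ℤ →
  p < m × (p ≤ a ⊎ b ≤ p)
depth≤0⇒outside {m = m} {a} {b} {p} 1+a<k a+2k≤b p∸m<k d≤0 with p ℕ.<? m
... | no  _ = contradiction d≤0 (ℤ.<⇒≱ (0<depth-centre 1+a<k a+2k≤b p∸m<k))
... | yes p<m with p ℕ.≤? a
...   | yes p≤a = p<m , inj₁ p≤a
...   | no  p≰a = p<m , inj₂ (ℕ.≮⇒≥ λ p<b → ℤ.<⇒≱ (0<depth-between (ℕ.≰⇒> p≰a) p<b) d≤0)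

configuration : ∀ k m n → Vector (Point 2) n
configuration k m n = rationalPoints (λ i → ι (abscissa k m (toℕ i))) (λ i → ι (ordinate k m (toℕ i)))

configuration-distinct : ∀ {k} m n → 0 < k → Distinct (configuration k m n)
configuration-distinct {k} m n 0<k {i} {j} i≢j Pi≈Pj = distinct (toℕ i) (toℕ j) (i≢j ∘ Fin.toℕ-injective)
  (ι-injective (fromℚ-injective (Pi≈Pj zero)))
  (ι-injective (fromℚ-injective (Pi≈Pj (suc zero))))
  where
  -- The tangent at `p` separates it even from the deep points, so nothing need be assumed about
  -- `r`.
  on-parabola : ∀ p r → p < m → abscissa k m p ≡ abscissa k m r →
    ordinate k m p ≡ ordinate k m r → p ≡ r
  on-parabola p r p<m x≡ y≡ with height≤0⇒between {k} {m} {p} {p} {r} ℕ.≤-refl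
      (ℕ.m<m+n p 0<k) (subst₂ (λ x y → height p p x y ℤ.≤ 0ℤ) x≡ y≡ (height-end≤0 p p p<m (inj₁ refl)))
  ... | _ , p≤r , r≤p = ℕ.≤-antisym p≤r r≤p

  off-parabola : ∀ p r → ¬ (p < m) → ¬ (r < m) → ordinate k m p ≡ ordinate k m r → p ≡ r
  off-parabola p r p≮m r≮m y≡ with p ℕ.<? m | r ℕ.<? m
  ... | yes p<m | _       = contradiction p<m p≮m
  ... | no _    | yes r<m = contradiction r<m r≮m
  ... | no _    | no _    = ℕ.∸-cancelʳ-≡ (ℕ.≮⇒≥ p≮m) (ℕ.≮⇒≥ r≮m)
    (ℤ.+-injective (∙-cancelˡ (+ 10 ℤ.* + k ℤ.* + k) _ _ y≡))
    where open AbelianGroupProperties ℤ.+-0-abelianGroup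

  distinct : ∀ p r → p ≢ r → abscissa k m p ≡ abscissa k m r → ordinate k m p ≢ ordinate k m r
  distinct p r p≢r x≡ y≡ = p≢r (equal (p ℕ.<? m) (r ℕ.<? m))
    where
    equal : Dec (p < m) → Dec (r < m) → p ≡ r
    equal (yes p<m) _         = on-parabola p r p<m x≡ y≡
    equal (no _)    (yes r<m) = sym (on-parabola r p r<m (sym x≡) (sym y≡))
    equal (no p≮m)  (no r≮m)  = off-parabola p r p≮m r≮m y≡

-- Tolerant partitions of the configuration

another : ∀ {k} → 2 ≤ k → (i : Fin k) → ∃[ j ] i ≢ j
another (s≤s (s≤s _)) zero    = suc zero , λ ()
another (s≤s (s≤s _)) (suc i) = zero , λ ()

module TolerantPartition {k t m n} (2≤k : 2 ≤ k) (1≤t : 1 ≤ t) (1+m≡k[t+2] : suc m ≡ k * (t + 2))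
  (few-central : ∀ (i : Fin n) → toℕ i ∸ m < k)
  {parts : Vector (Subset n) k}
  (disjoint : ∀ {i j} → i ≢ j → Empty (parts i ∩ parts j))
  (tolerant : IsTolerant t (configuration k m n) parts)
  where

  X Y : Vector ℤ n
  X i = abscissa k m (toℕ i)
  Y i = ordinate k m (toℕ i)

  0<k : 0 < k
  0<k = ℕ.<-trans (s≤s z≤n) 2≤k

  ∉-other : ∀ {A B i j} → A ≢ B → i ∈ parts A → j ∈ parts B → toℕ i ≢ toℕ j
  ∉-other {A} {B} {i} A≢B i∈A j∈B i≡j = disjoint A≢B
    (i , x∈p∩q⁺ (i∈A , subst (_∈ parts B) (sym (Fin.toℕ-injective i≡j)) j∈B))

  -- Otherwise all of `A` could be deleted: with `K = ⊥` even the constant form 1 satisfies the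
  -- hypothesis of `crossing`, which then yields `1 ≤ 0`.
  size>t : ∀ A → t < ∣ parts A ∣
  size>t A = ℕ.≰⇒> λ ∣A∣≤t →
    let B , A≢B = another 2≤k A
        i , _ , 1≤0 = crossing X Y tolerant disjoint A≢B ⊥
          (subst (λ S → ∣ S ∣ ≤ t) (sym (p─⊥≡p (parts A))) ∣A∣≤t) 0ℤ 0ℤ 1ℤ
          (λ i _ i∈⊥ → contradiction i∈⊥ ∉⊥)
    in ℤ.<⇒≱ {0ℤ} {1ℤ} (ℤ.+<+ (s≤s z≤n)) (subst (ℤ._≤ 0ℤ) (constant (abscissa k m (toℕ i)) (ordinate k m (toℕ i))) 1≤0)
    where
    constant : ∀ x y → 0ℤ ℤ.* x ℤ.+ 0ℤ ℤ.* y ℤ.+ 1ℤ ≡ 1ℤ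
    constant = solve-∀

  -- The tangent at i separates it from all other points.
  size>1+t : ∀ A {i} → i ∈ parts A → toℕ i < m → suc t < ∣ parts A ∣
  size>1+t A {i} i∈A i<m = ℕ.≰⇒> λ ∣A∣≤1+t →
    let B , A≢B = another 2≤k A
        a = toℕ i
        j , j∈B , h≤0 = crossing X Y tolerant disjoint A≢B ⁅ i ⁆
          (ℕ.≤-pred (ℕ.≤-trans (x∈p⇒∣p-x∣<∣p∣ i∈A) ∣A∣≤1+t)) (slope a a) 1ℤ (intercept a a)
          (λ j _ j∈⁅i⁆ → subst (λ j → height a a (abscissa k m (toℕ j)) (ordinate k m (toℕ j)) ℤ.≤ 0ℤ)
            (sym (x∈⁅y⁆⇒x≡y i j∈⁅i⁆)) (height-end≤0 a a i<m (inj₁ refl)))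
        _ , a≤j , j≤a = height≤0⇒between {k} {m} {a} {a} {toℕ j} ℕ.≤-refl (ℕ.m<m+n a 0<k) h≤0
    in ∉-other A≢B i∈A j∈B (ℕ.≤-antisym a≤j j≤a)

  -- At most `t` deletions reduce `A` to the pair `i`, `j`, so every other part has points on both
  -- closed sides of the line through them. `inner-gap` exploits the side below the chord,
  -- `outer-gap` the side above.
  module TightPart A (tight : ∣ parts A ∣ ≤ 2 + t)
    {i j} (i∈A : i ∈ parts A) (j∈A : j ∈ parts A) (i<j : toℕ i < toℕ j) (j<m : toℕ j < m) where

    a b : ℕ
    a = toℕ i
    b = toℕ j

    ∣A─ij∣≤t : ∣ parts A ─ (⁅ i ⁆ ∪ ⁅ j ⁆) ∣ ≤ t
    ∣A─ij∣≤t = subst (λ S → ∣ S ∣ ≤ t) (p─q─r≡p─q∪r (parts A) ⁅ i ⁆ ⁅ j ⁆)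
      (ℕ.≤-pred (ℕ.≤-trans (x∈p⇒∣p-x∣<∣p∣ (x∈p∧x≢y⇒x∈p-y j∈A (λ j≡i → ℕ.<-irrefl (cong toℕ (sym j≡i)) i<j)))
        (ℕ.≤-pred (ℕ.≤-trans (x∈p⇒∣p-x∣<∣p∣ i∈A) tight))))

    ∈ij⇒end : ∀ {x} → x ∈ ⁅ i ⁆ ∪ ⁅ j ⁆ → toℕ x < m × (toℕ x ≡ a ⊎ toℕ x ≡ b)
    ∈ij⇒end x∈ with x∈p∪q⁻ ⁅ i ⁆ ⁅ j ⁆ x∈
    ... | inj₁ x∈⁅i⁆ rewrite x∈⁅y⁆⇒x≡y i x∈⁅i⁆ = ℕ.<-trans i<j j<m , inj₁ refl
    ... | inj₂ x∈⁅j⁆ rewrite x∈⁅y⁆⇒x≡y j x∈⁅j⁆ = j<m , inj₂ refl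

    -- If the chord were short, all deep points would be above it, and each other part would need a
    -- point of the parabola strictly between `a` and `b`. Then all `k` parts meet the half-open
    -- interval from `a` to `b`, so its length is at least `k` after all.
    inner-gap : a + k ≤ b
    inner-gap = ℕ.≮⇒≥ λ b<a+k →
      ℕ.<⇒≱ (ℕ.+-cancelˡ-< a (b ∸ a) k (subst (_< a + k) (sym a+[b∸a]≡b) b<a+k))
        (transversal-bound {a = a} {b ∸ a} disjoint (λ {x} (_ : a ≤ toℕ x × toℕ x < b) → toℕ x)
          (λ _ _ → Fin.toℕ-injective)
          (λ {x} (a≤x , x<b) → a≤x , subst (toℕ x <_) (sym a+[b∸a]≡b) x<b)
          (hit b<a+k))
      where
      a+[b∸a]≡b : a + (b ∸ a) ≡ b
      a+[b∸a]≡b = ℕ.m+[n∸m]≡n (ℕ.<⇒≤ i<j)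
      hit : b < a + k → ∀ B → ∃[ x ] x ∈ parts B × (a ≤ toℕ x × toℕ x < b)
      hit b<a+k B with A Fin.≟ B
      -- `A` itself contributes the left endpoint; the right one is left out of the interval.
      ... | yes refl = i , i∈A , ℕ.≤-refl , i<j
      ... | no  A≢B  =
        let x , x∈B , h≤0 = crossing X Y tolerant disjoint A≢B (⁅ i ⁆ ∪ ⁅ j ⁆) ∣A─ij∣≤t
              (slope a b) 1ℤ (intercept a b)
              (λ x _ x∈ → let x<m , end = ∈ij⇒end x∈ in height-end≤0 a b x<m end)
            _ , a≤x , x≤b = height≤0⇒between {k} {m} {a} {b} {toℕ x} (ℕ.<⇒≤ i<j) b<a+k h≤0
        in x , x∈B , a≤x , ℕ.≤∧≢⇒< x≤b (∉-other A≢B j∈A x∈B ∘ sym)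

    -- Positions before a are shifted by m, continuing those from b to m − 1.
    outer-gap : b + k ≤ a + m
    outer-gap = ℕ.≮⇒≥ λ a+m<b+k →
      ℕ.<⇒≱ (ℕ.+-cancelˡ-< b (a + m ∸ b) k (subst (_< b + k) (sym b+d≡a+m) a+m<b+k))
        (transversal-bound {a = b} {a + m ∸ b} disjoint rotate rotate-injective rotate-bounds (hit a+m<b+k))
      where
      b+d≡a+m : b + (a + m ∸ b) ≡ a + m
      b+d≡a+m = ℕ.m+[n∸m]≡n (ℕ.≤-trans (ℕ.<⇒≤ j<m) (ℕ.m≤n+m m a))

      Outer : Fin n → Set
      Outer x = toℕ x < a ⊎ (b ≤ toℕ x × toℕ x < m)

      rotate : ∀ {x} → Outer x → ℕ
      rotate {x} (inj₁ _) = toℕ x + m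
      rotate {x} (inj₂ _) = toℕ x

      rotate-injective : ∀ {x y} (ox : Outer x) (oy : Outer y) → rotate ox ≡ rotate oy → x ≡ y
      rotate-injective (inj₁ _) (inj₁ _) eq = Fin.toℕ-injective (ℕ.+-cancelʳ-≡ m _ _ eq)
      rotate-injective {x} (inj₁ _) (inj₂ (_ , y<m)) eq =
        contradiction (ℕ.≤-trans (ℕ.m≤n+m m (toℕ x)) (ℕ.≤-reflexive eq)) (ℕ.<⇒≱ y<m)
      rotate-injective {y = y} (inj₂ (_ , x<m)) (inj₁ _) eq =
        contradiction (ℕ.≤-trans (ℕ.m≤n+m m (toℕ y)) (ℕ.≤-reflexive (sym eq))) (ℕ.<⇒≱ x<m)
      rotate-injective (inj₂ _) (inj₂ _) eq = Fin.toℕ-injective eq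

      rotate-bounds : ∀ {x} (ox : Outer x) → b ≤ rotate ox × rotate ox < b + (a + m ∸ b)
      rotate-bounds {x} (inj₁ x<a) =
          ℕ.≤-trans (ℕ.<⇒≤ j<m) (ℕ.m≤n+m m (toℕ x))
        , subst (toℕ x + m <_) (sym b+d≡a+m) (ℕ.+-monoˡ-< m x<a)
      rotate-bounds {x} (inj₂ (b≤x , x<m)) =
        b≤x , subst (toℕ x <_) (sym b+d≡a+m) (ℕ.<-≤-trans x<m (ℕ.m≤n+m m a))

      -- A short outer stretch forces `a` close to 0 and `b` far from `a`, which is what puts all
      -- deep points strictly below the chord.
      module _ (a+m<b+k : a + m < b + k) where
        open ℕ.≤-Reasoning

        1+a<k : suc a < k
        1+a<k = ℕ.+-cancelʳ-≤ b (2 + a) k (begin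
          2 + a + b         ≡⟨ cong suc (ℕ.+-suc a b) ⟨
          suc (a + suc b)     ≤⟨ s≤s (ℕ.+-monoʳ-≤ a j<m) ⟩
          suc (a + m)         ≤⟨ a+m<b+k ⟩
          b + k               ≡⟨ ℕ.+-comm b k ⟩
          k + b               ∎)

        a+2k≤b : a + (k + k) ≤ b
        a+2k≤b = ℕ.+-cancelʳ-≤ k (a + (k + k)) b (begin
          a + (k + k) + k  ≡⟨ regroup a k ⟩
          -- Here `1 ≤ t` gives `m + 1 = k (t + 2) ≥ 3k`.
          a + k * 3          ≤⟨ ℕ.+-monoʳ-≤ a (ℕ.*-monoʳ-≤ k (ℕ.+-monoˡ-≤ 2 1≤t)) ⟩
          a + k * (t + 2)  ≡⟨ cong (λ z → a + z) 1+m≡k[t+2] ⟨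
          a + suc m            ≡⟨ ℕ.+-suc a m ⟩
          suc (a + m)          ≤⟨ a+m<b+k ⟩
          b + k                ∎)
          where
          regroup : ∀ a k → a + (k + k) + k ≡ a + k * 3
          regroup = ℕSolver.solve-∀

        hit : ∀ B → ∃[ x ] x ∈ parts B × Outer x
        hit B with A Fin.≟ B
        ... | yes refl = j , j∈A , inj₂ (ℕ.≤-refl , j<m)
        ... | no  A≢B  with crossing X Y tolerant disjoint A≢B (⁅ i ⁆ ∪ ⁅ j ⁆) ∣A─ij∣≤t
              (ℤ.- slope a b) (ℤ.- 1ℤ) (ℤ.- intercept a b)
              (λ x _ x∈ → let x<m , end = ∈ij⇒end x∈ in depth-end≤0 a b x<m end)
        ...   | x , x∈B , d≤0 with depth≤0⇒outside {k} {m} {a} {b} {toℕ x} 1+a<k a+2k≤b (few-central x) d≤0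
        ...     | _   , inj₁ x≤a = x , x∈B , inj₁ (ℕ.≤∧≢⇒< x≤a (∉-other A≢B i∈A x∈B ∘ sym))
        ...     | x<m , inj₂ b≤x = x , x∈B , inj₂ (b≤x , x<m)

  -- Without deep points `A` has at least `t + 2` elements. The inner gaps put its extreme elements
  -- at least `k (t + 1)` apart, and the outer gap closes the cycle with another `k`. This needs
  -- `k (t + 2) ≤ m`, and `m` is one too small.
  tight⇒central : ∀ A → ∣ parts A ∣ ≤ 2 + t → ¬ (∀ {i} → i ∈ parts A → toℕ i < m)
  tight⇒central A tight all<m
    with spread k (parts A) nonempty (λ i∈A j∈A i<j → TightPart.inner-gap A tight i∈A j∈A i<j (all<m j∈A))
    where
    nonempty : Nonempty (parts A)
    nonempty = decidable-stable (nonempty? (parts A)) λ empty →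
      ℕ.n≮0 (subst (t <_) (trans (cong ∣_∣ (Empty-unique empty)) (∣⊥∣≡0 n)) (size>t A))
  ... | i , j , i∈A , j∈A , i+k∣A∣≤j+k = ℕ.<⇒≱ {m} (ℕ.≤-reflexive (1+m≡k[t+2]))
    (ℕ.+-cancelˡ-≤ (toℕ i) (k * (t + 2)) m
      (ℕ.≤-trans i+k[t+2]≤j+k (TightPart.outer-gap A tight i∈A j∈A i<j (all<m j∈A))))
    where
    open ℕ.≤-Reasoning
    i+k[t+2]≤j+k : toℕ i + k * (t + 2) ≤ toℕ j + k
    i+k[t+2]≤j+k = begin
      toℕ i + k * (t + 2)      ≡⟨ cong (λ z → toℕ i + k * z) (ℕ.+-comm t 2) ⟩
      toℕ i + k * (2 + t)      ≤⟨ ℕ.+-monoʳ-≤ (toℕ i) (ℕ.*-monoʳ-≤ k (size>1+t A i∈A (all<m i∈A))) ⟩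
      toℕ i + k * ∣ parts A ∣    ≤⟨ i+k∣A∣≤j+k ⟩
      toℕ j + k                    ∎
    -- The extreme elements must differ before the outer gap can be applied to them.
    i<j : toℕ i < toℕ j
    i<j = ℕ.+-cancelʳ-< k (toℕ i) (toℕ j) (begin-strict
      toℕ i + k                  <⟨ ℕ.+-monoʳ-< (toℕ i) (ℕ.m<m*n k (t + 2) {{ℕ.>-nonZero 0<k}} (ℕ.m≤n+m 2 t)) ⟩
      toℕ i + k * (t + 2)    ≤⟨ i+k[t+2]≤j+k ⟩
      toℕ j + k                  ∎)

  -- A part of deep points only counts at least `2 (t + 1)`, which suffices as `1 ≤ t`. A mixed part
  -- has `t + 2` points by the tangent argument, and a deep one counted again. A part without deep
  -- points cannot be tight.
  weighted-size : ∀ A → t + 3 ≤ ∣ parts A ∣ + ∣ parts A ∩ from m ∣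
  weighted-size A with Fin.any? (λ i → i ∈? parts A ×-dec toℕ i ℕ.<? m)
  ... | no none = begin
    t + 3            ≡⟨ ℕ.+-suc t 2 ⟩
    suc t + 2        ≤⟨ ℕ.+-mono-≤ (size>t A) (ℕ.≤-trans (s≤s 1≤t) (size>t A)) ⟩
    ∣ parts A ∣ + ∣ parts A ∣
      ≤⟨ ℕ.+-monoʳ-≤ ∣ parts A ∣ (p⊆q⇒∣p∣≤∣q∣ λ {i} i∈A →
           x∈p∩q⁺ (i∈A , ∈-from m i (ℕ.≮⇒≥ λ i<m → none (i , i∈A , i<m)))) ⟩
    ∣ parts A ∣ + ∣ parts A ∩ from m ∣ ∎
    where open ℕ.≤-Reasoning
  ... | yes (i , i∈A , i<m) with nonempty? (parts A ∩ from m)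
  ...   | yes central = begin
    t + 3            ≡⟨ reorder t ⟩
    2 + t + 1      ≤⟨ ℕ.+-mono-≤ (size>1+t A i∈A i<m) (nonempty⇒∣p∣>0 central) ⟩
    ∣ parts A ∣ + ∣ parts A ∩ from m ∣ ∎
    where
    open ℕ.≤-Reasoning
    reorder : ∀ t → t + 3 ≡ 2 + t + 1
    reorder = ℕSolver.solve-∀
  ...   | no none = begin
    t + 3            ≡⟨ ℕ.+-comm t 3 ⟩
    3 + t            ≤⟨ ℕ.≰⇒> (λ tight → tight⇒central A tight
                            λ {i} i∈A → ℕ.≰⇒> λ m≤i → none (i , x∈p∩q⁺ (i∈A , ∈-from m i m≤i))) ⟩
    ∣ parts A ∣        ≤⟨ ℕ.m≤m+n ∣ parts A ∣ _ ⟩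
    ∣ parts A ∣ + ∣ parts A ∩ from m ∣ ∎
    where open ℕ.≤-Reasoning

  k[t+3]≤n+central : k * (t + 3) ≤ n + ∣ from {n} m ∣
  k[t+3]≤n+central = begin
    k * (t + 3)
      ≤⟨ *≤sumℕ _ (t + 3) weighted-size ⟩
    sumℕ (λ A → ∣ parts A ∣ + ∣ parts A ∩ from m ∣)
      ≡⟨ sumℕ-+ (λ A → ∣ parts A ∣) (λ A → ∣ parts A ∩ from m ∣) ⟩
    sumℕ (λ A → ∣ parts A ∣) + sumℕ (λ A → ∣ parts A ∩ from m ∣)
      ≤⟨ ℕ.+-mono-≤
           (sumℕ-disjoint≤ parts ⊤ disjoint (λ _ → ⊆⊤))
           (sumℕ-disjoint≤ (λ A → parts A ∩ from m) (from m)
             (λ A≢B (x , x∈) → let x∈A∩ , x∈B∩ = x∈p∩q⁻ _ _ x∈ in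
               disjoint A≢B (x , x∈p∩q⁺ (p∩q⊆p _ _ x∈A∩ , p∩q⊆p _ _ x∈B∩)))
             (λ A → p∩q⊆q (parts A) (from m))) ⟩
    ∣ ⊤ {n} ∣ + ∣ from {n} m ∣
      ≡⟨ cong (_+ ∣ from {n} m ∣) (∣⊤∣≡n n) ⟩
    n + ∣ from {n} m ∣ ∎
    where open ℕ.≤-Reasoning

-- The lower bound for the tolerance number

theorem6 : ∀ (c : ℕ) → 1 ≤ c →
    ∀ (k t : ℕ) → 2 * c ≤ k → c ≤ t →
    ∀ (N : ℕ) → IsToleranceNumber 2 k t N → k * (t + 2) + c ≤ N
theorem6 c 1≤c k t 2c≤k c≤t N isN = ℕ.≮⇒≥ λ N<k[t+2]+c →
  -- The goal is now absurdity, so a partition may be taken out of the double negation.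
  IsToleranceNumber.suffices isN (configuration k m N) (configuration-distinct m N 0<k)
    λ (parts , partition , tolerant) → too-few N<k[t+2]+c (TolerantPartition.k[t+3]≤n+central
      2≤k (ℕ.≤-trans 1≤c c≤t) 1+m≡k[t+2] (few-central N<k[t+2]+c)
      (IsPartition.disjoint partition) tolerant)
  where
  open ℕ.≤-Reasoning
  2≤k : 2 ≤ k
  2≤k = ℕ.≤-trans (ℕ.*-monoʳ-≤ 2 1≤c) 2c≤k
  0<k : 0 < k
  0<k = ℕ.<-trans (s≤s z≤n) 2≤k
  c≤k : c ≤ k
  c≤k = ℕ.≤-trans (ℕ.m≤m+n c (c + 0)) 2c≤k

  -- If `N ≤ m`, the first `N` points include no deep one, and the same count still applies.
  m : ℕ
  m = ℕ.pred (k * (t + 2))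
  1+m≡k[t+2] : suc m ≡ k * (t + 2)
  1+m≡k[t+2] = ℕ.suc-pred (k * (t + 2)) {{ℕ.>-nonZero (ℕ.*-mono-≤ 0<k (ℕ.≤-trans (s≤s z≤n) (ℕ.m≤n+m 2 t)))}}

  module _ (N<k[t+2]+c : N < k * (t + 2) + c) where
    N≤m+c : N ≤ m + c
    N≤m+c = ℕ.≤-pred (subst (λ z → N < z + c) (sym 1+m≡k[t+2]) N<k[t+2]+c)

    few-central : ∀ (i : Fin N) → toℕ i ∸ m < k
    few-central i = ℕ.<-≤-trans
      (ℕ.m<n+o⇒m∸n<o (toℕ i) m {{ℕ.>-nonZero 1≤c}} (ℕ.<-≤-trans (Fin.toℕ<n i) N≤m+c)) c≤k

    too-few : ¬ (k * (t + 3) ≤ N + ∣ from {N} m ∣)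
    too-few k[t+3]≤ = ℕ.<-irrefl refl (begin-strict
      k * (t + 3)            ≤⟨ k[t+3]≤ ⟩
      N + ∣ from {N} m ∣     ≤⟨ ℕ.+-monoʳ-≤ N (∣from∣≤ m N≤m+c) ⟩
      N + c                  <⟨ ℕ.+-monoˡ-< c N<k[t+2]+c ⟩
      k * (t + 2) + c + c    ≡⟨ regroup k t c ⟩
      -- One `c` bounds the number of points beyond `k (t + 2)`, the other the second counting of
      -- the deep points.
      k * (t + 2) + 2 * c    ≤⟨ ℕ.+-monoʳ-≤ (k * (t + 2)) 2c≤k ⟩
      k * (t + 2) + k        ≡⟨ distribute k t ⟩
      k * (t + 3)            ∎)
      where
      regroup : ∀ k t c → k * (t + 2) + c + c ≡ k * (t + 2) + 2 * c
      regroup = ℕSolver.solve-∀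
      distribute : ∀ k t → k * (t + 2) + k ≡ k * (t + 3)
      distribute = ℕSolver.solve-∀
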